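{- Let $(x,y),(x',y'),(x'',y'')\in\mathbb Z_{\ge0}^2$ be three points with $x\ge y$, $x'\ge y'$ and $x''\ge y''$. If $(x',y')=\frac{(x,y)+(x'',y'')}{2}$, then $$m_{x,y}+m_{x'',y''}\ge 2m_{x',y'}.$$
   Context: For $A=(x,y)\in\mathbb Z_{\ge0}^2$ with $y\le x$, $m_{x,y}=|OA|$ is the Markov distance from $O=(0,0)$ to $A$: the number obtained from the element of the once-punctured torus cluster algebra attached to the left deformation of the segment $OA$ by specializing the three initial cluster variables to $1$. Concretely, for coprime $(x,y)$ the number $m_{x,y}$ is the Markov number attached to the Farey fraction $y/x$: $m_{1,0}=m_{0,1}=1$, $m_{1,1}=2$, and whenever $(a,b),(c,d)\in\mathbb Z_{\ge0}^2$ satisfy $|ad-bc|=1$ and $\{(a,b),(c,d)\}\ne\{(1,0),(0,1)\}$, $m_{a+c,b+d}=3m_{a,b}m_{c,d}-m_{|a-c|,|b-d|}$ (e.g. $m_{2,1}=5$, $m_{3,1}=13$, $m_{3,2}=29$). For non-coprime points: if $q,p$ are coprime and $f_n=m_{nq,np}$, then $f_0=0$, $f_1=m_{q,p}$, $f_n=3f_1f_{n-1}-f_{n-2}$ for $n\ge2$; in particular $m_{0,0}=0$. -}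

module Defs where

open import Data.Empty using (⊥-elim)
open import Data.Integer.Base using (ℤ; +_; 0ℤ; 1ℤ) renaming (_+_ to _+ℤ_; _*_ to _*ℤ_; _-_ to _-ℤ_)
open import Data.Integer.Tactic.RingSolver using (solve-∀)
open import Data.Nat.Base using (ℕ; zero; suc; _+_; _*_; _∸_; ∣_-_∣; _≤_; _<_; z≤n; s≤s)
open import Data.Nat.Coprimality using (Coprime; 0-coprimeTo-m⇒m≡1) renaming (sym to coprime-sym)
open import Data.Nat.Divisibility using (∣m∣n⇒∣m+n)
open import Data.Nat.Properties
open import Data.Nat.Tactic.RingSolver using () renaming (solve-∀ to solveℕ-∀)
open import Data.Product.Base using (_×_; _,_)
open import Data.Sum.Base using (inj₁; inj₂)
open import Relation.Binary.Definitions using (tri<; tri≈; tri>)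
open import Relation.Binary.PropositionalEquality
open import Relation.Nullary using (¬_)

-- multiple a n is the value f n of the sequence attached to the n-fold
-- multiple of a primitive vector of value a; for n = 1 this is a.

multiple : ℤ → ℕ → ℤ
multiple a zero          = 0ℤ
multiple a (suc zero)    = a
multiple a (suc (suc n)) = + 3 *ℤ a *ℤ multiple a (suc n) -ℤ multiple a n

-- Let u, v be a basis of ℤ², and let a, b, c be the values at u, v, u + v.
-- Then walk n s t a b c is the value at s u + t v.  The step is the Euclidean
-- algorithm on (s , t), replacing v by u + v (or u by u + v); it mutates the
-- Markov triple (a , b , c), because the value at u + (u + v) is 3 a c - b.
-- The first argument is fuel: s + t always suffices, so the clause returning
-- 0 is never reached from m.

walk : (n s t : ℕ) (a b c : ℤ) → ℤ
walk n       s       zero    a b c = multiple a s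
walk n       zero    (suc t) a b c = multiple b (suc t)
walk zero    (suc s) (suc t) a b c = 0ℤ
walk (suc n) (suc s) (suc t) a b c with <-cmp (suc s) (suc t)
... | tri< _ _ _ = walk n (suc s) (t ∸ s) c b (+ 3 *ℤ c *ℤ b -ℤ a)
... | tri≈ _ _ _ = multiple c (suc s)
... | tri> _ _ _ = walk n (s ∸ t) (suc t) a c (+ 3 *ℤ a *ℤ c -ℤ b)

-- The Markov distance from (0 , 0) to (x , y).

m : ℕ → ℕ → ℤ
m x y = walk (x + y) x y 1ℤ 1ℤ (+ 2)

-- The defining relations of the Markov distance; m-isMarkovDistance at the
-- end of the file shows that m satisfies them.

record IsMarkovDistance (f : ℕ → ℕ → ℤ) : Set where
  field
    at-1-0   : f 1 0 ≡ 1ℤ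
    at-0-1   : f 0 1 ≡ 1ℤ
    at-1-1   : f 1 1 ≡ + 2
    mediant  : ∀ a b c d → ∣ a * d - b * c ∣ ≡ 1 →
               ¬ ((a , b) ≡ (1 , 0) × (c , d) ≡ (0 , 1)) →
               ¬ ((a , b) ≡ (0 , 1) × (c , d) ≡ (1 , 0)) →
               f (a + c) (b + d) ≡ + 3 *ℤ f a b *ℤ f c d -ℤ f ∣ a - c ∣ ∣ b - d ∣
    at-0-0   : f 0 0 ≡ 0ℤ
    multiples : ∀ q p → Coprime q p → ∀ n →
                f (suc (suc n) * q) (suc (suc n) * p) ≡
                + 3 *ℤ f q p *ℤ f (suc n * q) (suc n * p) -ℤ f (n * q) (n * p)

private

  W : (s t : ℕ) (a b c : ℤ) → ℤ
  W s t = walk (s + t) s t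

  walk-fuel : ∀ n n' s t a b c → s + t ≤ n → s + t ≤ n' →
              walk n s t a b c ≡ walk n' s t a b c
  walk-fuel n n' s       zero    a b c _ _ = refl
  walk-fuel n n' zero    (suc t) a b c _ _ = refl
  walk-fuel (suc n) (suc n') (suc s) (suc t) a b c (s≤s p) (s≤s p')
    with <-cmp (suc s) (suc t)
  ... | tri< s<t _ _ = walk-fuel n n' (suc s) (t ∸ s) _ _ _ (≤-trans le p) (≤-trans le p')
    where
    le : suc s + (t ∸ s) ≤ s + suc t
    le = ≤-trans (≤-reflexive (cong suc (m+[n∸m]≡n (<⇒≤ (≤-pred s<t))))) (m≤n+m (suc t) s)
  ... | tri≈ _ _ _ = refl
  ... | tri> _ _ _ = walk-fuel n n' (s ∸ t) (suc t) _ _ _ (≤-trans le p) (≤-trans le p')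
    where
    le : s ∸ t + suc t ≤ s + suc t
    le = +-monoˡ-≤ (suc t) (m∸n≤m s t)

  W-right : ∀ k t a b c → W (t + k) t a b c ≡ W k t a c (+ 3 *ℤ a *ℤ c -ℤ b)
  W-right k       zero    a b c = refl
  W-right zero    (suc t) a b c with <-cmp (suc (t + 0)) (suc t)
  ... | tri< _ ≢ _ = ⊥-elim (≢ (cong suc (+-identityʳ t)))
  ... | tri≈ _ _ _ = cong (multiple c) (cong suc (+-identityʳ t))
  ... | tri> _ ≢ _ = ⊥-elim (≢ (cong suc (+-identityʳ t)))
  W-right (suc k) (suc t) a b c with <-cmp (suc (t + suc k)) (suc t)
  ... | tri< _ _ ≯ = ⊥-elim (≯ (s≤s (m<m+n t (s≤s z≤n))))
  ... | tri≈ _ _ ≯ = ⊥-elim (≯ (s≤s (m<m+n t (s≤s z≤n))))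
  ... | tri> _ _ _ rewrite m+n∸m≡n t (suc k) =
    walk-fuel (t + suc k + suc t) (suc k + suc t) (suc k) (suc t) _ _ _
      (+-monoˡ-≤ (suc t) (m≤n+m (suc k) t)) ≤-refl

  W-left : ∀ s k a b c → W s (s + k) a b c ≡ W s k c b (+ 3 *ℤ c *ℤ b -ℤ a)
  W-left zero    zero    a b c = refl
  W-left zero    (suc k) a b c = refl
  W-left (suc s) zero    a b c with <-cmp (suc s) (suc (s + 0))
  ... | tri< _ ≢ _ = ⊥-elim (≢ (cong suc (sym (+-identityʳ s))))
  ... | tri≈ _ _ _ = refl
  ... | tri> _ ≢ _ = ⊥-elim (≢ (cong suc (sym (+-identityʳ s))))
  W-left (suc s) (suc k) a b c with <-cmp (suc s) (suc (s + suc k))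
  ... | tri> ≮ _ _ = ⊥-elim (≮ (s≤s (m<m+n s (s≤s z≤n))))
  ... | tri≈ ≮ _ _ = ⊥-elim (≮ (s≤s (m<m+n s (s≤s z≤n))))
  ... | tri< _ _ _ rewrite m+n∸m≡n s (suc k) =
    walk-fuel (s + suc (s + suc k)) (suc s + suc k) (suc s) (suc k) _ _ _
      (m≤n+m (suc (s + suc k)) s) ≤-refl

  W-multiple : ∀ N s t → s + t ≤ N → Coprime s t → ∀ n a b c →
               W (n * s) (n * t) a b c ≡ multiple (W s t a b c) n
  W-multiple N s zero _ co n a b c
    rewrite 0-coprimeTo-m⇒m≡1 (coprime-sym co) | *-zeroʳ n | *-identityʳ n = refl
  W-multiple N zero (suc t) _ co n a b c
    with refl ← 0-coprimeTo-m⇒m≡1 co rewrite *-zeroʳ n | *-identityʳ n = lem n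
    where
    lem : ∀ n → W 0 n a b c ≡ multiple b n
    lem zero    = refl
    lem (suc n) = refl
  W-multiple (suc N) (suc s) (suc t) (s≤s le) co n a b c with ≤-total (suc s) (suc t)
  ... | inj₁ s≤t with k , refl ← m≤n⇒∃[o]m+o≡n s≤t
    rewrite *-distribˡ-+ n (suc s) k
          | W-left (n * suc s) (n * k) a b c | W-left (suc s) k a b c
    = W-multiple N (suc s) k (≤-trans (m≤n+m _ s) le)
        (λ (d₁ , d₂) → co (d₁ , ∣m∣n⇒∣m+n d₁ d₂)) n _ _ _
  ... | inj₂ t≤s with k , refl ← m≤n⇒∃[o]m+o≡n t≤s
    rewrite *-distribˡ-+ n (suc t) k
          | W-right (n * k) (n * suc t) a b c | W-right k (suc t) a b c
    = W-multiple N k (suc t) (≤-trans (+-monoˡ-≤ (suc t) (m≤n+m k t)) le)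
        (λ (d₁ , d₂) → co (∣m∣n⇒∣m+n d₂ d₁ , d₂)) n _ _ _

  opposite : ∀ u v w z → v < u → z < w → ∣ u * w - v * z ∣ ≡ 1 →
             (u ≡ 1 × w ≡ 1) × (v ≡ 0 × z ≡ 0)
  opposite u v w z v<u z<w det
    with k , refl ← m≤n⇒∃[o]m+o≡n v<u | l , refl ← m≤n⇒∃[o]m+o≡n z<w
    = conclude k l v z (suc-injective (trans (sym eq) det))
    where
    rest : ℕ
    rest = (k + k * l + k * z + v + v * l) + (l + z)
    expand : ∀ k l v z → (1 + v + k) * (1 + z + l) ≡
             v * z + (1 + ((k + k * l + k * z + v + v * l) + (l + z)))
    expand = solveℕ-∀
    eq : ∣ (suc v + k) * (suc z + l) - v * z ∣ ≡ suc rest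
    eq = trans (cong (λ h → ∣ h - v * z ∣) (expand k l v z))
           (trans (∣-∣-comm (v * z + suc rest) (v * z)) (∣m-m+n∣≡n (v * z) (suc rest)))
    conclude : ∀ k l v z → (k + k * l + k * z + v + v * l) + (l + z) ≡ 0 →
               (suc v + k ≡ 1 × suc z + l ≡ 1) × (v ≡ 0 × z ≡ 0)
    conclude zero zero zero zero _ = (refl , refl) , refl , refl

  data Basis : (s t s' t' : ℕ) → Set where
    standard : Basis 1 0 0 1
    swapped  : Basis 0 1 1 0
    right    : ∀ t k t' k' → Basis (t + k) t (t' + k') t'
    left     : ∀ s k s' k' → Basis s (s + k) s' (s' + k')

  basis : ∀ s t s' t' → ∣ s * t' - t * s' ∣ ≡ 1 → Basis s t s' t'
  basis s t s' t' det with ≤-<-connex s t | ≤-<-connex s' t' | ≤-<-connex t s | ≤-<-connex t' s'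
  ... | inj₁ p | inj₁ q | _ | _
    with k , refl ← m≤n⇒∃[o]m+o≡n p | k' , refl ← m≤n⇒∃[o]m+o≡n q = left s k s' k'
  ... | _ | _ | inj₁ p | inj₁ q
    with k , refl ← m≤n⇒∃[o]m+o≡n p | k' , refl ← m≤n⇒∃[o]m+o≡n q = right t k t' k'
  ... | inj₂ p | _ | inj₂ q | _ = ⊥-elim (<-asym p q)
  ... | _ | inj₂ p | _ | inj₂ q = ⊥-elim (<-asym p q)
  ... | inj₂ p | inj₁ _ | inj₁ _ | inj₂ q
    with (refl , refl) , refl , refl ← opposite s t t' s' p q det = standard
  ... | inj₁ _ | inj₂ p | inj₂ q | inj₁ _
    with (refl , refl) , refl , refl ← opposite t s s' t' q p
           (trans (∣-∣-comm (t * s') (s * t')) det) = swapped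

  det-right : ∀ t k t' k' → ∣ (t + k) * t' - t * (t' + k') ∣ ≡ ∣ k * t' - t * k' ∣
  det-right t k t' k'
    rewrite *-distribʳ-+ t' t k | *-distribˡ-+ t t' k' = ∣m+n-m+o∣≡∣n-o∣ (t * t') _ _

  det-left : ∀ s k s' k' → ∣ s * (s' + k') - (s + k) * s' ∣ ≡ ∣ s * k' - k * s' ∣
  det-left s k s' k'
    rewrite *-distribʳ-+ s' s k | *-distribˡ-+ s s' k' = ∣m+n-m+o∣≡∣n-o∣ (s * s') _ _

  Exchange : (s t s' t' : ℕ) → Set
  Exchange s t s' t' = ∀ a b c →
    W (s + (s + s')) (t + (t + t')) a b c ≡
    + 3 *ℤ W s t a b c *ℤ W (s + s') (t + t') a b c -ℤ W s' t' a b c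

  regroup₂ : ∀ t k t' k' → (t + k) + (t' + k') ≡ (t + t') + (k + k')
  regroup₂ = solveℕ-∀

  regroup₃ : ∀ t k t' k' →
             (t + k) + ((t + k) + (t' + k')) ≡ (t + (t + t')) + (k + (k + k'))
  regroup₃ = solveℕ-∀

  exchange-right : ∀ t k t' k' → Exchange k t k' t' → Exchange (t + k) t (t' + k') t'
  exchange-right t k t' k' ih a b c
    rewrite regroup₃ t k t' k' | regroup₂ t k t' k'
          | W-right (k + (k + k')) (t + (t + t')) a b c | W-right (k + k') (t + t') a b c
          | W-right k t a b c | W-right k' t' a b c
    = ih _ _ _

  exchange-left : ∀ s k s' k' → Exchange s k s' k' → Exchange s (s + k) s' (s' + k')
  exchange-left s k s' k' ih a b c
    rewrite regroup₃ s k s' k' | regroup₂ s k s' k'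
          | W-left (s + (s + s')) (k + (k + k')) a b c | W-left (s + s') (k + k') a b c
          | W-left s k a b c | W-left s' k' a b c
    = ih _ _ _

  exchange : ∀ N s t s' t' → s + t + (s' + t') ≤ N →
             ∣ s * t' - t * s' ∣ ≡ 1 → Exchange s t s' t'
  exchange N s t s' t' le det with basis s t s' t' det
  ... | standard = λ a b c → refl
  ... | swapped  = λ a b c → cong (_-ℤ a) (swap b c)
    where
    swap : ∀ b c → + 3 *ℤ c *ℤ b ≡ + 3 *ℤ b *ℤ c
    swap = solve-∀
  exchange N _ _ _ _ le det | right zero k zero k' rewrite *-zeroʳ k with () ← det
  exchange (suc N) _ _ _ _ le det | right (suc t) k t' k' =
    exchange-right (suc t) k t' k' (exchange N k (suc t) k' t'
      (≤-pred (≤-trans (s≤s (+-mono-≤ (+-monoˡ-≤ (suc t) (m≤n+m k t)) (+-monoˡ-≤ t' (m≤n+m k' t')))) le))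
      (trans (sym (det-right (suc t) k t' k')) det))
  exchange zero _ _ _ _ le det | right zero k (suc t') k'
    with () ← m+n≡0⇒n≡0 (k + 0) (n≤0⇒n≡0 le)
  exchange (suc N) _ _ _ _ le det | right zero k (suc t') k' =
    exchange-right zero k (suc t') k' (exchange N k 0 k' (suc t')
      (≤-pred (≤-trans (≤-trans (≤-reflexive (sym (+-suc (k + 0) (k' + suc t'))))
        (+-monoʳ-≤ (k + 0) (s≤s (+-monoˡ-≤ (suc t') (m≤n+m k' t'))))) le))
      (trans (sym (det-right zero k (suc t') k')) det))
  exchange N _ _ _ _ le det | left zero k zero k' rewrite *-zeroʳ k with () ← det
  exchange (suc N) _ _ _ _ le det | left (suc s) k s' k' =
    exchange-left (suc s) k s' k' (exchange N (suc s) k s' k'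
      (≤-pred (≤-trans (s≤s (+-mono-≤ (m≤n+m (suc s + k) s) (+-monoʳ-≤ s' (m≤n+m k' s')))) le))
      (trans (sym (det-left (suc s) k s' k')) det))
  exchange zero _ _ _ _ le det | left zero k (suc s') k'
    with () ← m+n≡0⇒n≡0 k (n≤0⇒n≡0 le)
  exchange (suc N) _ _ _ _ le det | left zero k (suc s') k' =
    exchange-left zero k (suc s') k' (exchange N 0 k (suc s') k'
      (≤-pred (≤-trans (≤-trans (≤-reflexive (sym (+-suc k (suc s' + k'))))
        (+-monoʳ-≤ k (s≤s (m≤n+m (suc s' + k') s')))) le))
      (trans (sym (det-left zero k (suc s') k')) det))

  Mediant : (a b c d : ℕ) → Set
  Mediant a b c d =
    m (a + c) (b + d) ≡ + 3 *ℤ m a b *ℤ m c d -ℤ m ∣ a - c ∣ ∣ b - d ∣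

  mediant-≤ : ∀ a b c d → a ≤ c → b ≤ d → ∣ a * d - b * c ∣ ≡ 1 → Mediant a b c d
  mediant-≤ a b c d a≤c b≤d det
    with k , refl ← m≤n⇒∃[o]m+o≡n a≤c | l , refl ← m≤n⇒∃[o]m+o≡n b≤d
    rewrite ∣m-m+n∣≡n a k | ∣m-m+n∣≡n b l
    = exchange _ a b k l ≤-refl (trans (sym lem) det) _ _ _
    where
    lem : ∣ a * (b + l) - b * (a + k) ∣ ≡ ∣ a * l - b * k ∣
    lem rewrite *-distribˡ-+ a b l | *-distribˡ-+ b a k | *-comm a b =
      ∣m+n-m+o∣≡∣n-o∣ (b * a) _ _

  mediant-swap : ∀ a b c d → Mediant c d a b → Mediant a b c d
  mediant-swap a b c d eq
    rewrite +-comm a c | +-comm b d | ∣-∣-comm a c | ∣-∣-comm b d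
    = trans eq (cong (_-ℤ m ∣ c - a ∣ ∣ d - b ∣) (swap (m c d) (m a b)))
    where
    swap : ∀ x y → + 3 *ℤ x *ℤ y ≡ + 3 *ℤ y *ℤ x
    swap = solve-∀

  mediant-all : ∀ a b c d → ∣ a * d - b * c ∣ ≡ 1 →
                ¬ ((a , b) ≡ (1 , 0) × (c , d) ≡ (0 , 1)) →
                ¬ ((a , b) ≡ (0 , 1) × (c , d) ≡ (1 , 0)) → Mediant a b c d
  mediant-all a b c d det ¬std ¬swp
    with ≤-<-connex a c | ≤-<-connex b d | ≤-<-connex c a | ≤-<-connex d b
  ... | inj₁ p | inj₁ q | _ | _ = mediant-≤ a b c d p q det
  ... | _ | _ | inj₁ p | inj₁ q =
    mediant-swap a b c d (mediant-≤ c d a b p q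
      (trans (cong₂ ∣_-_∣ (*-comm c b) (*-comm d a)) (trans (∣-∣-comm (b * c) (a * d)) det)))
  ... | inj₂ p | _ | inj₂ q | _ = ⊥-elim (<-asym p q)
  ... | _ | inj₂ p | _ | inj₂ q = ⊥-elim (<-asym p q)
  ... | inj₂ p | inj₁ _ | inj₁ _ | inj₂ q
    with (refl , refl) , refl , refl ← opposite a c d b p q
           (trans (cong (λ h → ∣ a * d - h ∣) (*-comm c b)) det)
    = ⊥-elim (¬std (refl , refl))
  ... | inj₁ _ | inj₂ p | inj₂ q | inj₁ _
    with (refl , refl) , refl , refl ← opposite b d c a p q
           (trans (cong (λ h → ∣ b * c - h ∣) (*-comm d a))
             (trans (∣-∣-comm (b * c) (a * d)) det))
    = ⊥-elim (¬swp (refl , refl))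

m-isMarkovDistance : IsMarkovDistance m
m-isMarkovDistance = record
  { at-1-0    = refl
  ; at-0-1    = refl
  ; at-1-1    = refl
  ; mediant   = mediant-all
  ; at-0-0    = refl
  ; multiples = λ q p co n →
      let f = λ i → W-multiple _ q p ≤-refl co i 1ℤ 1ℤ (+ 2) in
      trans (f (suc (suc n)))
        (cong₂ (λ h g → + 3 *ℤ m q p *ℤ h -ℤ g) (sym (f (suc n))) (sym (f n)))
  }

{-# OPTIONS --safe #-}

-- For 0 ≤ y ≤ x write (x , y) = (x - y) (1 , 0) + y (1 , 1) and read a lattice
-- path from the origin as a word in u = (1 , 0) and v = (1 , 1).  The words act
-- by the Cohn matrices of u and v, and m x y is the upper right entry of the
-- product along the Christoffel word, which minimises this entry among all
-- words with the same numbers of u and v.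
--
-- Let P be the midpoint of A and C.  If C dominates A in these coordinates, P
-- is obtained by deleting letters from a word for C, and each deletion at least
-- halves the entry, so m C ≥ 2 m P unless A = C.  Otherwise the path of C from
-- the origin and the path of A from P - A cross.  Exchanging their tails at the
-- crossing gives two paths with content P, and by a 2 × 2 determinant identity
-- the product of the entries does not increase.  So m A m C ≥ (m P)², and the
-- inequality between the arithmetic and geometric means concludes.

module Submission where

open import Defs
open import Data.Empty using (⊥-elim)
open import Data.Integer.Base as ℤ using (ℤ; +_)
import Data.Integer.Properties as ℤ
open import Data.List.Base using (List; []; _∷_; _++_; map; replicate)
open import Data.List.Properties using (++-assoc; ++-identityʳ; map-++)
open import Data.Nat.Base
open import Data.Nat.ListAction using (sum)
open import Data.Nat.ListAction.Properties using (sum-++)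
open import Data.Nat.Properties
open import Data.Nat.Tactic.RingSolver using (solve-∀)
open import Data.Product.Base using (∃; ∃₂; _×_; _,_; proj₁; proj₂)
open import Data.Sum.Base using (_⊎_; inj₁; inj₂)
open import Relation.Binary.Definitions using (tri<; tri≈; tri>)
open import Relation.Binary.PropositionalEquality

-- Words in two letters and Markov functionals on them

data Letter : Set where
  u v : Letter

Word : Set
Word = List Letter

pattern uv x = u ∷ v ∷ x
pattern vu x = v ∷ u ∷ x

power : Word → ℕ → Word
power p zero    = []
power p (suc n) = p ++ power p n

-- The relation M² + 1 = (tr M) M for a matrix M of determinant 1, placed between contexts `x` and
-- `y`. It is free of subtraction, so all values stay in ℕ.
record CayleyHamilton (E t : Word → ℕ) : Set where
  field
    ch : ∀ x p y → E (x ++ p ++ p ++ y) + E (x ++ y) ≡ t p * E (x ++ p ++ y)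

-- E is the upper right entry and t the trace of the matrix of a word.  The last
-- four fields give the sign of the commutator K = vu - uv between contexts.
record MarkovFunctional (E t : Word → ℕ) : Set where
  field
    E-[]     : E [] ≡ 0
    E-ch     : CayleyHamilton E t
    t-ch     : CayleyHamilton t t
    t-cyclic : ∀ x y → t (x ++ y) ≡ t (y ++ x)
    t≥2      : ∀ w → 2 ≤ t w
    t-u      : t (u ∷ []) ≡ 3 * E (u ∷ [])
    t-v      : t (v ∷ []) ≡ 3 * E (v ∷ [])
    t-uv     : t (uv []) ≡ 3 * E (uv [])
    inner-≥  : ∀ x y → E (x ++ v ∷ uv (u ∷ y)) ≤ E (x ++ v ∷ vu (u ∷ y))
    left-≥   : ∀ y → E (uv y) ≤ E (vu y)
    right-≥  : ∀ x → E (x ++ uv []) ≤ E (x ++ vu [])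
    inner-≤  : ∀ x y → E (x ++ u ∷ vu (v ∷ y)) ≤ E (x ++ u ∷ uv (v ∷ y))

substitute : ∀ {A : Set} → (A → Word) → List A → Word
substitute f []      = []
substitute f (ℓ ∷ w) = f ℓ ++ substitute f w

substitute-++ : ∀ {A : Set} (f : A → Word) x y →
                substitute f (x ++ y) ≡ substitute f x ++ substitute f y
substitute-++ f []      y = refl
substitute-++ f (ℓ ∷ x) y rewrite substitute-++ f x y =
  sym (++-assoc (f ℓ) (substitute f x) (substitute f y))

-- Passing from the basis (u , v) to (u , u + v), respectively (u + v , v).
σ τ : Letter → Word
σ u = u ∷ []
σ v = uv []
τ u = uv []
τ v = v ∷ []

cayleyHamilton-substitute : ∀ {E t} f → CayleyHamilton E t →
  CayleyHamilton (λ w → E (substitute f w)) (λ w → t (substitute f w))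
cayleyHamilton-substitute {E} {t} f C = record { ch = ch′ }
  where
  open CayleyHamilton C
  ch′ : ∀ x p y → E (substitute f (x ++ p ++ p ++ y)) + E (substitute f (x ++ y))
              ≡ t (substitute f p) * E (substitute f (x ++ p ++ y))
  ch′ x p y
    rewrite substitute-++ f x (p ++ p ++ y) | substitute-++ f x (p ++ y)
          | substitute-++ f p (p ++ y) | substitute-++ f p y | substitute-++ f x y
    = ch (substitute f x) (substitute f p) (substitute f y)

-- The commutator K = vu - uv in context

data StartsWithU : Word → Set where
  []  : StartsWithU []
  u∷_ : ∀ w → StartsWithU (u ∷ w)

data EndsWithV : Word → Set where
  []   : EndsWithV []
  _∷ʳv : ∀ w → EndsWithV (w ++ v ∷ [])

-- Nonempty images under `σ` begin with `u`, and nonempty images under `τ` end with `v`. With the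
-- latter on its left and the former on its right, `vu` dominates `uv`.
σ-startsWithU : ∀ w → StartsWithU (substitute σ w)
σ-startsWithU []      = []
σ-startsWithU (u ∷ w) = u∷ _
σ-startsWithU (v ∷ w) = u∷ _

++v∷-endsWithV : ∀ x {w} → EndsWithV w → EndsWithV (x ++ v ∷ w)
++v∷-endsWithV x []       = x ∷ʳv
++v∷-endsWithV x (w ∷ʳv) rewrite sym (++-assoc x (v ∷ w) (v ∷ [])) = (x ++ v ∷ w) ∷ʳv

τ-endsWithV : ∀ w → EndsWithV (substitute τ w)
τ-endsWithV []      = []
τ-endsWithV (u ∷ w) = ++v∷-endsWithV (u ∷ []) (τ-endsWithV w)
τ-endsWithV (v ∷ w) = ++v∷-endsWithV [] (τ-endsWithV w)

≤-transfer : ∀ {a b a′ b′} → a + b ≡ a′ + b′ → b ≤ b′ → a′ ≤ a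
≤-transfer {a} {b} {a′} {b′} e b≤b′ = +-cancelʳ-≤ b a′ a
  (≤-trans (+-monoʳ-≤ a′ b≤b′) (≤-reflexive (sym e)))

-- uKu = K = vKv for K = vu - uv.
module Conjugation {E t} (C : CayleyHamilton E t) where
  open CayleyHamilton C

  -- Cayley-Hamilton at the square in `uvuu` and at the one in `uuvu`: both sums equal `t (u ∷ [])`
  -- times the value at `x uvu y`.
  conjugate-u : ∀ x y → E (x ++ u ∷ vu (u ∷ y)) + E (x ++ uv y)
                      ≡ E (x ++ u ∷ uv (u ∷ y)) + E (x ++ vu y)
  conjugate-u x y = trans
    (subst₂ (λ a b → E a + E b ≡ t (u ∷ []) * E (x ++ u ∷ vu y))
      (++-assoc x (uv []) (u ∷ u ∷ y)) (++-assoc x (uv []) y)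
      (trans (ch (x ++ uv []) (u ∷ []) y)
             (cong (λ w → t (u ∷ []) * E w) (++-assoc x (uv []) (u ∷ y)))))
    (sym (ch x (u ∷ []) (vu y)))

  conjugate-v : ∀ x y → E (x ++ v ∷ vu (v ∷ y)) + E (x ++ uv y)
                      ≡ E (x ++ v ∷ uv (v ∷ y)) + E (x ++ vu y)
  conjugate-v x y = trans (ch x (v ∷ []) (uv y))
    (sym (subst₂ (λ a b → E a + E b ≡ t (v ∷ []) * E (x ++ v ∷ uv y))
      (++-assoc x (vu []) (v ∷ v ∷ y)) (++-assoc x (vu []) y)
      (trans (ch (x ++ vu []) (v ∷ []) y)
             (cong (λ w → t (v ∷ []) * E w) (++-assoc x (vu []) (v ∷ y))))))

-- Closure of Markov functionals under `σ` and `τ`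

module Functional {E t} (M : MarkovFunctional E t) where
  open MarkovFunctional M
  open CayleyHamilton

  -- This is `left-≥` or `right-≥` when that side of the context is empty, and `inner-≥` when a `v`
  -- precedes and a `u` follows.
  uv≤vu : ∀ {x y} → EndsWithV x → StartsWithU y → E (x ++ uv y) ≤ E (x ++ vu y)
  uv≤vu []       _        = left-≥ _
  uv≤vu (x ∷ʳv) []       = right-≥ (x ++ v ∷ [])
  uv≤vu (x ∷ʳv) (u∷ y)
    rewrite ++-assoc x (v ∷ []) (uv (u ∷ y)) | ++-assoc x (v ∷ []) (vu (u ∷ y)) = inner-≥ x y

  -- The mutation 3ac - b of the values a, b, c at `u`, `v`, `uv`: Cayley-Hamilton for the square in
  -- `uuv`.
  E-uuv : E (u ∷ uv []) + E (v ∷ []) ≡ 3 * E (u ∷ []) * E (uv [])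
  E-uuv rewrite sym t-u = ch E-ch [] (u ∷ []) (v ∷ [])

  E-uvv : E (uv (v ∷ [])) + E (u ∷ []) ≡ 3 * E (uv []) * E (v ∷ [])
  E-uvv = trans (trans (ch E-ch (u ∷ []) (v ∷ []) []) (cong (_* E (uv [])) t-v))
                (swap (E (v ∷ [])) (E (uv [])))
    where
    swap : ∀ a b → 3 * a * b ≡ 3 * b * a
    swap = solve-∀

  -- `t` and `E` satisfy the same recurrence, so the factor 3 between them passes from `u`, `v` and
  -- `uv` to `uuv`.
  t-uuv : t (u ∷ uv []) ≡ 3 * E (u ∷ uv [])
  t-uuv = +-cancelʳ-≡ (t (v ∷ [])) _ _ (trans (ch t-ch [] (u ∷ []) (v ∷ []))
    (trans (cong₂ _*_ t-u t-uv) (trans (lemma (E (u ∷ [])) (E (uv [])))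
    (trans (cong (3 *_) (sym E-uuv)) (trans (*-distribˡ-+ 3 (E (u ∷ uv [])) _)
    (cong (λ h → 3 * E (u ∷ uv []) + h) (sym t-v)))))))
    where
    lemma : ∀ a b → 3 * a * (3 * b) ≡ 3 * (3 * a * b)
    lemma = solve-∀

  t-uvv : t (uv (v ∷ [])) ≡ 3 * E (uv (v ∷ []))
  t-uvv = +-cancelʳ-≡ (t (u ∷ [])) _ _ (trans (ch t-ch (u ∷ []) (v ∷ []) [])
    (trans (cong₂ _*_ t-v t-uv) (trans (lemma (E (v ∷ [])) (E (uv [])))
    (trans (cong (3 *_) (sym E-uvv)) (trans (*-distribˡ-+ 3 (E (uv (v ∷ []))) _)
    (cong (λ h → 3 * E (uv (v ∷ [])) + h) (sym t-u)))))))
    where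
    lemma : ∀ a b → 3 * a * (3 * b) ≡ 3 * (3 * b * a)
    lemma = solve-∀

  reassoc : ∀ x p {y z} → E ((x ++ p) ++ y) ≤ E ((x ++ p) ++ z) →
            E (x ++ p ++ y) ≤ E (x ++ p ++ z)
  reassoc x p {y} {z} = subst₂ (λ a b → E a ≤ E b) (++-assoc x p y) (++-assoc x p z)

  unassoc : ∀ x p {y z} → E (x ++ p ++ y) ≤ E (x ++ p ++ z) →
            E ((x ++ p) ++ y) ≤ E ((x ++ p) ++ z)
  unassoc x p {y} {z} =
    subst₂ (λ a b → E a ≤ E b) (sym (++-assoc x p y)) (sym (++-assoc x p z))

  along : ∀ (f : Letter → Word) x {y z} →
          E (substitute f x ++ substitute f y) ≤ E (substitute f x ++ substitute f z) →
          E (substitute f (x ++ y)) ≤ E (substitute f (x ++ z))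
  along f x {y} {z} =
    subst₂ (λ a b → E a ≤ E b) (sym (substitute-++ f x y)) (sym (substitute-++ f x z))

  cyclic : ∀ (f : Letter → Word) x y → t (substitute f (x ++ y)) ≡ t (substitute f (y ++ x))
  cyclic f x y rewrite substitute-++ f x y | substitute-++ f y x =
    t-cyclic (substitute f x) (substitute f y)

  -- Makes induction along the Euclidean algorithm possible. The sign conditions after substitution
  -- reduce to those for `E`, because every `uKu` that arises collapses to K.
  σ-functional : MarkovFunctional (λ w → E (substitute σ w)) (λ w → t (substitute σ w))
  σ-functional = record
    { E-[] = E-[]
    ; E-ch = cayleyHamilton-substitute σ E-ch
    ; t-ch = cayleyHamilton-substitute σ t-ch
    ; t-cyclic = cyclic σ
    ; t≥2 = λ w → t≥2 (substitute σ w)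
    ; t-u = t-u
    ; t-v = t-uv
    ; t-uv = t-uuv
    ; inner-≥ = λ x y → along σ x (inner (substitute σ x) (σ-startsWithU y))
    ; left-≥ = λ y → left (σ-startsWithU y)
    ; right-≥ = λ x → along σ x
        (reassoc (substitute σ x) (u ∷ []) (right-≥ (substitute σ x ++ u ∷ [])))
    ; inner-≤ = λ x y → along σ x (reassoc (substitute σ x) (u ∷ [])
        (≤-transfer (sym (conjugate-u (substitute σ x ++ u ∷ []) (v ∷ substitute σ y)))
          (unassoc (substitute σ x) (u ∷ []) (inner-≤ (substitute σ x) (substitute σ y)))))
    }
    where
    open Conjugation E-ch
    inner : ∀ x {y} → StartsWithU y →
            E (x ++ uv (u ∷ uv (u ∷ y))) ≤ E (x ++ uv (u ∷ vu (u ∷ y)))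
    inner x {y} Y = reassoc x (uv []) (≤-transfer (conjugate-u (x ++ uv []) y)
      (uv≤vu (subst EndsWithV (++-assoc x (u ∷ []) (v ∷ [])) ((x ++ u ∷ []) ∷ʳv)) Y))
    left : ∀ {y} → StartsWithU y → E (u ∷ uv y) ≤ E (u ∷ vu y)
    left []     = right-≥ (u ∷ [])
    left (u∷ y) = ≤-transfer (conjugate-u [] y) (left-≥ y)

  -- The same argument with `vKv` in place of `uKu` and final letters `v` in place of initial
  -- letters `u`.
  τ-functional : MarkovFunctional (λ w → E (substitute τ w)) (λ w → t (substitute τ w))
  τ-functional = record
    { E-[] = E-[]
    ; E-ch = cayleyHamilton-substitute τ E-ch
    ; t-ch = cayleyHamilton-substitute τ t-ch
    ; t-cyclic = cyclic τ
    ; t≥2 = λ w → t≥2 (substitute τ w)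
    ; t-u = t-uv
    ; t-v = t-v
    ; t-uv = t-uvv
    ; inner-≥ = λ x y → along τ x (≤-transfer (conjugate-v (substitute τ x) (uv (substitute τ y)))
        (uv≤vu (τ-endsWithV x) (u∷ _)))
    ; left-≥ = λ y → left-≥ (v ∷ substitute τ y)
    ; right-≥ = λ x → along τ x (right (τ-endsWithV x))
    ; inner-≤ = λ x y → along τ x (reassoc (substitute τ x) (u ∷ [])
        (≤-transfer (sym (conjugate-v (substitute τ x ++ u ∷ []) (v ∷ substitute τ y)))
          (unassoc (substitute τ x) (u ∷ []) (inner-≤ (substitute τ x) (substitute τ y)))))
    }
    where
    open Conjugation E-ch
    right : ∀ {x} → EndsWithV x → E (x ++ uv (v ∷ [])) ≤ E (x ++ vu (v ∷ []))
    right []       = left-≥ (v ∷ [])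
    right (x ∷ʳv) = unassoc x (v ∷ []) (≤-transfer (conjugate-v x []) (right-≥ x))

-- Letter counts and a comparison of recurrences

weight : ∀ {A : Set} → (A → ℕ) → List A → ℕ
weight f xs = sum (map f xs)

weight-++ : ∀ {A : Set} (f : A → ℕ) xs ys → weight f (xs ++ ys) ≡ weight f xs + weight f ys
weight-++ f xs ys = trans (cong sum (map-++ f xs ys)) (sum-++ (map f xs) (map f ys))

isU isV : Letter → ℕ
isU u = 1
isU v = 0
isV u = 0
isV v = 1

#u #v : Word → ℕ
#u = weight isU
#v = weight isV

-- The difference f - g of two solutions of h (n + 2) = T h (n + 1) - h n is
-- again a solution, and it is increasing once it is so initially.
recurrence-≤ : ∀ (f g : ℕ → ℕ) {T} → 2 ≤ T →
  (∀ n → f (2 + n) + f n ≡ T * f (1 + n)) → (∀ n → g (2 + n) + g n ≡ T * g (1 + n)) →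
  g 0 ≡ f 0 → g 1 ≤ f 1 → ∀ n → g n ≤ f n
recurrence-≤ f g {suc (suc T)} (s≤s (s≤s z≤n)) F G eq le n = proj₁ (both n)
  where
  Increasing : ℕ → Set
  Increasing n = g (suc n) + f n ≤ f (suc n) + g n
  next : ∀ n → g n ≤ f n → Increasing n → g (suc n) ≤ f (suc n)
  next n p q = +-cancelʳ-≤ (f n) _ _ (≤-trans q (+-monoʳ-≤ (f (suc n)) p))
  expand₁ : ∀ T g₁ f₁ f₀ → (2 + T) * g₁ + (f₁ + f₀) ≡ T * g₁ + (g₁ + f₀) + (g₁ + f₁)
  expand₁ = solve-∀
  expand₂ : ∀ T g₁ f₁ g₀ → T * f₁ + (f₁ + g₀) + (g₁ + f₁) ≡ (2 + T) * f₁ + (g₁ + g₀)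
  expand₂ = solve-∀
  regroup : ∀ a b c d → a + b + (c + d) ≡ a + c + (b + d)
  regroup = solve-∀
  regroup′ : ∀ a b c d → a + c + (b + d) ≡ a + b + (d + c)
  regroup′ = solve-∀
  both : ∀ n → g n ≤ f n × Increasing n
  both zero    = ≤-reflexive eq , +-mono-≤ le (≤-reflexive (sym eq))
  both (suc n) with both n
  -- With d = f - g and `T` the coefficient less 2, d (n + 2) - d (n + 1) = T d (n + 1) + (d (n + 1)
  -- - d n), a sum of two nonnegative terms.
  ... | p , q = next n p q , +-cancelʳ-≤ (g n + f n) _ _ (begin
    g (2 + n) + f (1 + n) + (g n + f n)       ≡⟨ regroup (g (2 + n)) (f (1 + n)) (g n) (f n) ⟩
    g (2 + n) + g n + (f (1 + n) + f n)       ≡⟨ cong (_+ (f (1 + n) + f n)) (G n) ⟩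
    (2 + T) * g (1 + n) + (f (1 + n) + f n)   ≡⟨ expand₁ T (g (1 + n)) (f (1 + n)) (f n) ⟩
    T * g (1 + n) + (g (1 + n) + f n) + (g (1 + n) + f (1 + n))
      ≤⟨ +-monoˡ-≤ (g (1 + n) + f (1 + n)) (+-mono-≤ (*-monoʳ-≤ T (next n p q)) q) ⟩
    T * f (1 + n) + (f (1 + n) + g n) + (g (1 + n) + f (1 + n))
      ≡⟨ expand₂ T (g (1 + n)) (f (1 + n)) (g n) ⟩
    (2 + T) * f (1 + n) + (g (1 + n) + g n)   ≡⟨ cong (_+ (g (1 + n) + g n)) (sym (F n)) ⟩
    f (2 + n) + f n + (g (1 + n) + g n)       ≡⟨ regroup′ (f (2 + n)) (g (1 + n)) (f n) (g n) ⟩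
    f (2 + n) + g (1 + n) + (g n + f n)       ∎)
    where open ≤-Reasoning

-- Grouping letters into tokens

shift : ∀ ℓ ℓ′ n y → power (ℓ ∷ ℓ′ ∷ []) n ++ ℓ ∷ y ≡ ℓ ∷ power (ℓ′ ∷ ℓ ∷ []) n ++ y
shift ℓ ℓ′ zero    y = refl
shift ℓ ℓ′ (suc n) y = cong (λ w → ℓ ∷ ℓ′ ∷ w) (shift ℓ ℓ′ n y)

-- `W` is a pair `u`, `v` already merged. A string without `V`, or without `U`, spells an image
-- under `σ`, or under `τ`.
data Token : Set where
  U V W : Token

spell : Token → Word
spell U = u ∷ []
spell V = v ∷ []
spell W = uv []

spell-replicate : ∀ n T → substitute spell (replicate n W ++ T) ≡ power (uv []) n ++ substitute spell T
spell-replicate zero    T = refl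
spell-replicate (suc n) T = cong (λ w → uv w) (spell-replicate n T)

toToken σ-token τ-token : Letter → Token
toToken u = U
toToken v = V
σ-token u = U
σ-token v = W
τ-token u = W
τ-token v = V

-- A string of tokens without a factor U Wᵏ V has the form x y with x in
-- {V, W}* and y in {U, W}*.
data Factor : List Token → Set where
  noV : ∀ w → Factor (map σ-token w)
  noU : ∀ w → Factor (map τ-token w)
  UWV : ∀ x n y → Factor (x ++ U ∷ replicate n W ++ V ∷ y)
  VWU : ∀ x n y → Factor (map τ-token x ++ V ∷ replicate n W ++ U ∷ map σ-token y)

data LeadingW (ℓ : Token) (T : List Token) : Set where
  all  : ∀ n → T ≡ replicate n W → LeadingW ℓ T
  then : ∀ n T′ → T ≡ replicate n W ++ ℓ ∷ T′ → LeadingW ℓ T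

consW : ∀ {ℓ T} → LeadingW ℓ T → LeadingW ℓ (W ∷ T)
consW (all n refl)     = all (suc n) refl
consW (then n T′ refl) = then (suc n) T′ refl

leading-V : ∀ w → LeadingW V (map τ-token w)
leading-V []      = all 0 refl
leading-V (u ∷ w) = consW (leading-V w)
leading-V (v ∷ w) = then 0 _ refl

leading-U : ∀ w → (∃ λ n → map σ-token w ≡ replicate n W) ⊎
                  (∃₂ λ n y → map σ-token w ≡ replicate n W ++ U ∷ map σ-token y)
leading-U []      = inj₁ (0 , refl)
leading-U (u ∷ w) = inj₂ (0 , w , refl)
leading-U (v ∷ w) with leading-U w
... | inj₁ (n , eq)     = inj₁ (suc n , cong (W ∷_) eq)
... | inj₂ (n , y , eq) = inj₂ (suc n , y , cong (W ∷_) eq)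

first-V : ∀ x T → ∃₂ λ n y → map τ-token x ++ V ∷ T ≡ replicate n W ++ V ∷ y
first-V []      T = 0 , T , refl
first-V (v ∷ x) T = 0 , _ , refl
first-V (u ∷ x) T with first-V x T
... | n , y , eq = suc n , y , cong (W ∷_) eq

map-replicate-σ : ∀ n → map σ-token (replicate n v) ≡ replicate n W
map-replicate-σ zero    = refl
map-replicate-σ (suc n) = cong (W ∷_) (map-replicate-σ n)

map-replicate-τ : ∀ n → map τ-token (replicate n u) ≡ replicate n W
map-replicate-τ zero    = refl
map-replicate-τ (suc n) = cong (W ∷_) (map-replicate-τ n)

factor : ∀ T → Factor T
factor []      = noV []
factor (U ∷ T) with factor T
... | noV w     = noV (u ∷ w)
... | UWV x n y = UWV (U ∷ x) n y
... | VWU x n y with first-V x (replicate n W ++ U ∷ map σ-token y)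
...   | k , z , eq rewrite eq = UWV [] k z
factor (U ∷ .(map τ-token w)) | noU w with leading-V w
...   | all n eq rewrite eq | sym (map-replicate-σ n) = noV (u ∷ replicate n v)
...   | then n y eq rewrite eq = UWV [] n y
factor (V ∷ T) with factor T
... | noU w     = noU (v ∷ w)
... | UWV x n y = UWV (V ∷ x) n y
... | VWU x n y = VWU (v ∷ x) n y
... | noV w with leading-U w
...   | inj₁ (n , eq) rewrite eq | sym (map-replicate-τ n) = noU (v ∷ replicate n u)
...   | inj₂ (n , y , eq) rewrite eq = VWU [] n y
factor (W ∷ T) with factor T
... | noV w     = noV (v ∷ w)
... | noU w     = noU (u ∷ w)
... | UWV x n y = UWV (W ∷ x) n y
... | VWU x n y = VWU (u ∷ x) n y

isU′ isV′ isW′ : Token → ℕ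
isU′ U = 1
isU′ V = 0
isU′ W = 0
isV′ U = 0
isV′ V = 1
isV′ W = 0
isW′ U = 0
isW′ V = 0
isW′ W = 1

#U #V #W : List Token → ℕ
#U = weight isU′
#V = weight isV′
#W = weight isW′

weight-insert : ∀ f ℓ ℓ′ x n y → weight f (x ++ ℓ ∷ replicate n W ++ ℓ′ ∷ y) + f W
  ≡ weight f (x ++ W ∷ replicate n W ++ y) + (f ℓ + f ℓ′)
weight-insert f ℓ ℓ′ x n y
  rewrite weight-++ f x (ℓ ∷ replicate n W ++ ℓ′ ∷ y) | weight-++ f x (W ∷ replicate n W ++ y)
        | weight-++ f (replicate n W) (ℓ′ ∷ y) | weight-++ f (replicate n W) y
  = lemma (weight f x) (f ℓ) (weight f (replicate n W)) (f ℓ′) (weight f y) (f W)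
  where
  lemma : ∀ x ℓ n ℓ′ y w → x + (ℓ + (n + (ℓ′ + y))) + w ≡ x + (w + (n + y)) + (ℓ + ℓ′)
  lemma = solve-∀

weight-drop : ∀ f ℓ ℓ′ x n y → f W ≡ 0 → f ℓ + f ℓ′ ≡ 1 →
  weight f (x ++ ℓ ∷ replicate n W ++ ℓ′ ∷ y) ≡ suc (weight f (x ++ W ∷ replicate n W ++ y))
weight-drop f ℓ ℓ′ x n y fW fℓ with weight-insert f ℓ ℓ′ x n y
... | eq rewrite fW | fℓ = trans (sym (+-identityʳ _)) (trans eq (+-comm _ 1))

weight-add : ∀ f ℓ ℓ′ x n y → f W ≡ 1 → f ℓ + f ℓ′ ≡ 0 →
  suc (weight f (x ++ ℓ ∷ replicate n W ++ ℓ′ ∷ y)) ≡ weight f (x ++ W ∷ replicate n W ++ y)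
weight-add f ℓ ℓ′ x n y fW fℓ with weight-insert f ℓ ℓ′ x n y
... | eq rewrite fW | fℓ = trans (+-comm 1 _) (trans eq (+-identityʳ _))

-- Merging letters without increasing the functional

module Minimality {E t} (M : MarkovFunctional E t) where
  open MarkovFunctional M
  open CayleyHamilton
  open Functional M

  E′ : List Token → ℕ
  E′ T = E (substitute spell T)

  -- Both sides obey the Cayley-Hamilton recurrence with the same trace and agree at exponent 0, so
  -- the comparison at exponent 1 passes to all exponents.
  power-≤ : ∀ p q x y → t p ≡ t q → E (x ++ p ++ y) ≤ E (x ++ q ++ y) →
            ∀ n → E (x ++ power p n ++ y) ≤ E (x ++ power q n ++ y)
  power-≤ p q x y tr le = recurrence-≤ (λ n → E (x ++ power q n ++ y)) (λ n → E (x ++ power p n ++ y))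
    (t≥2 q) (recurrence q) (λ n → trans (recurrence p n) (cong (_* E (x ++ power p (suc n) ++ y)) tr)) refl
    (subst₂ (λ a b → E (x ++ a) ≤ E (x ++ b)) (once p) (once q) le)
    where
    once : ∀ r → r ++ y ≡ power r 1 ++ y
    once r = sym (++-assoc r [] y)
    recurrence : ∀ r n → E (x ++ power r (2 + n) ++ y) + E (x ++ power r n ++ y)
                       ≡ t r * E (x ++ power r (1 + n) ++ y)
    recurrence r n rewrite ++-assoc r (r ++ power r n) y | ++-assoc r (power r n) y =
      ch E-ch x r (power r n ++ y)

  t-swap : t (uv []) ≡ t (vu [])
  t-swap = t-cyclic (u ∷ []) (v ∷ [])

  spell-σ : ∀ w → substitute spell (map σ-token w) ≡ substitute σ w
  spell-σ []      = refl
  spell-σ (u ∷ w) = cong (u ∷_) (spell-σ w)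
  spell-σ (v ∷ w) = cong (λ w → uv w) (spell-σ w)

  spell-τ : ∀ w → substitute spell (map τ-token w) ≡ substitute τ w
  spell-τ []      = refl
  spell-τ (u ∷ w) = cong (λ w → uv w) (spell-τ w)
  spell-τ (v ∷ w) = cong (v ∷_) (spell-τ w)

  -- Since (uv)^(n+1) = u (vu)^n v, the words differ by `vu` against `uv` between a `u` and a `v`,
  -- where `inner-≤` makes `vu` the smaller.
  merge-UWV : ∀ x n y → E′ (x ++ W ∷ replicate n W ++ y) ≤ E′ (x ++ U ∷ replicate n W ++ V ∷ y)
  merge-UWV x n y
    rewrite substitute-++ spell x (W ∷ replicate n W ++ y)
          | substitute-++ spell x (U ∷ replicate n W ++ V ∷ y)
          | spell-replicate n y | spell-replicate n (V ∷ y)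
          | sym (shift v u n (substitute spell y))
    = reassoc X (u ∷ []) (power-≤ (vu []) (uv []) (X ++ u ∷ []) (v ∷ Y) (sym t-swap)
        (unassoc X (u ∷ []) (inner-≤ X Y)) n)
    where
    X = substitute spell x
    Y = substitute spell y

  -- Since v (uv)^n u = (vu)^(n+1), the words differ by `uv` against `vu`, and the shapes of the two
  -- contexts are those of `uv≤vu`.
  merge-VWU : ∀ x n y → E′ (map τ-token x ++ W ∷ replicate n W ++ map σ-token y)
                      ≤ E′ (map τ-token x ++ V ∷ replicate n W ++ U ∷ map σ-token y)
  merge-VWU x n y
    rewrite substitute-++ spell (map τ-token x) (W ∷ replicate n W ++ map σ-token y)
          | substitute-++ spell (map τ-token x) (V ∷ replicate n W ++ U ∷ map σ-token y)
          | spell-replicate n (map σ-token y) | spell-replicate n (U ∷ map σ-token y)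
          | shift u v n (substitute spell (map σ-token y))
          | spell-σ y | spell-τ x
    = power-≤ (uv []) (vu []) (substitute τ x) (substitute σ y) t-swap
        (uv≤vu (τ-endsWithV x) (σ-startsWithU y)) (suc n)

  Pure : List Token → Set
  Pure T =
    (∃ λ w → E (substitute σ w) ≤ E′ T × #u w + #V T ≡ #U T × #v w ≡ #W T + #V T) ⊎
    (∃ λ w → E (substitute τ w) ≤ E′ T × #v w + #U T ≡ #V T × #u w ≡ #W T + #U T)

  merge-pure : ∀ {T T′} → E′ T′ ≤ E′ T → #U T ≡ suc (#U T′) → #V T ≡ suc (#V T′) →
               suc (#W T) ≡ #W T′ → Pure T′ → Pure T
  merge-pure {T} {T′} le eU eV eW (inj₁ (w , a , b , c)) rewrite eU | eV | sym eW =
    inj₁ (w , ≤-trans a le , trans (+-suc (#u w) (#V T′)) (cong suc b) ,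
          trans c (sym (+-suc (#W T) (#V T′))))
  merge-pure {T} {T′} le eU eV eW (inj₂ (w , a , b , c)) rewrite eU | eV | sym eW =
    inj₂ (w , ≤-trans a le , trans (+-suc (#v w) (#U T′)) (cong suc b) ,
          trans c (sym (+-suc (#W T) (#U T′))))

  #-σ : ∀ w → #u w ≡ #U (map σ-token w) × 0 ≡ #V (map σ-token w) × #v w ≡ #W (map σ-token w)
  #-σ []      = refl , refl , refl
  #-σ (u ∷ w) with #-σ w
  ... | a , b , c = cong suc a , b , c
  #-σ (v ∷ w) with #-σ w
  ... | a , b , c = a , b , cong suc c

  #-τ : ∀ w → #v w ≡ #V (map τ-token w) × 0 ≡ #U (map τ-token w) × #u w ≡ #W (map τ-token w)
  #-τ []      = refl , refl , refl
  #-τ (u ∷ w) with #-τ w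
  ... | a , b , c = a , b , cong suc c
  #-τ (v ∷ w) with #-τ w
  ... | a , b , c = cong suc a , b , c

  purify : ∀ n T → #V T ≤ n → Pure T
  purify-merged : ∀ n T T′ → E′ T′ ≤ E′ T → #U T ≡ suc (#U T′) → #V T ≡ suc (#V T′) →
                  suc (#W T) ≡ #W T′ → #V T ≤ n → Pure T
  purify n T le with factor T
  ... | noV w with #-σ w
  ...   | a , b , c rewrite sym b = inj₁
    (w , ≤-reflexive (cong E (sym (spell-σ w))) , trans (+-identityʳ (#u w)) a ,
     trans c (sym (+-identityʳ _)))
  purify n T le | noU w with #-τ w
  ...   | a , b , c rewrite sym b = inj₂
    (w , ≤-reflexive (cong E (sym (spell-τ w))) , trans (+-identityʳ (#v w)) a ,
     trans c (sym (+-identityʳ _)))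
  purify n T le | UWV x k y = purify-merged n (x ++ U ∷ replicate k W ++ V ∷ y) (x ++ W ∷ replicate k W ++ y)
    (merge-UWV x k y)
    (weight-drop isU′ U V x k y refl refl) (weight-drop isV′ U V x k y refl refl)
    (weight-add isW′ U V x k y refl refl) le
  purify n T le | VWU x k y = purify-merged n (map τ-token x ++ V ∷ replicate k W ++ U ∷ map σ-token y)
    (map τ-token x ++ W ∷ replicate k W ++ map σ-token y) (merge-VWU x k y)
    (weight-drop isU′ V U (map τ-token x) k (map σ-token y) refl refl)
    (weight-drop isV′ V U (map τ-token x) k (map σ-token y) refl refl)
    (weight-add isW′ V U (map τ-token x) k (map σ-token y) refl refl) le

  purify-merged zero    T T′ _ _ eV _ le with () ← ≤-trans (≤-reflexive (sym eV)) le
  purify-merged (suc n) T T′ E≤ eU eV eW le = merge-pure {T} {T′} E≤ eU eV eW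
    (purify n T′ (≤-pred (≤-trans (≤-reflexive (sym eV)) le)))

  spell-letters : ∀ w → substitute spell (map toToken w) ≡ w
  spell-letters []      = refl
  spell-letters (u ∷ w) = cong (u ∷_) (spell-letters w)
  spell-letters (v ∷ w) = cong (v ∷_) (spell-letters w)

  #-letters : ∀ w → #U (map toToken w) ≡ #u w × #V (map toToken w) ≡ #v w × #W (map toToken w) ≡ 0
  #-letters []      = refl , refl , refl
  #-letters (u ∷ w) with #-letters w
  ... | a , b , c = cong suc a , b , c
  #-letters (v ∷ w) with #-letters w
  ... | a , b , c = a , cong suc b , c

  -- Merging starts from a string without `W` and ends when one of `u`, `v` is used up. On the
  -- counts (`#u w` , `#v w`) this is a subtraction step of the Euclidean algorithm.
  descend : ∀ w →
    (∃ λ w′ → E (substitute σ w′) ≤ E w × #u w′ + #v w ≡ #u w × #v w′ ≡ #v w) ⊎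
    (∃ λ w′ → E (substitute τ w′) ≤ E w × #v w′ + #u w ≡ #v w × #u w′ ≡ #u w)
  descend w with purify _ (map toToken w) ≤-refl | #-letters w
  ... | P | a , b , c rewrite spell-letters w | a | b | c = P

-- Cohn matrices

record Matrix : Set where
  constructor matrix
  field
    m₁₁ m₁₂ m₂₁ m₂₂ : ℕ

open Matrix

infixr 7 _·_
_·_ : Matrix → Matrix → Matrix
matrix a b c d · matrix a′ b′ c′ d′ =
  matrix (a * a′ + b * c′) (a * b′ + b * d′) (c * a′ + d * c′) (c * b′ + d * d′)

-- The upper right entries 1, 2 and, for `uv`, 5 are the Markov numbers of (1 , 0), (1 , 1) and (2 ,
-- 1). The traces 3, 6 and 15 are three times these.
cohn : Letter → Matrix
cohn u = matrix 2 1 1 1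
cohn v = matrix 5 2 2 1

cohnWord : Word → Matrix
cohnWord []      = matrix 1 0 0 1
cohnWord (ℓ ∷ w) = cohn ℓ · cohnWord w

entry trace : Word → ℕ
entry w = m₁₂ (cohnWord w)
trace w = m₁₁ (cohnWord w) + m₂₂ (cohnWord w)

matrix-≡ : ∀ {a b c d a′ b′ c′ d′} → a ≡ a′ → b ≡ b′ → c ≡ c′ → d ≡ d′ →
           matrix a b c d ≡ matrix a′ b′ c′ d′
matrix-≡ refl refl refl refl = refl

·-assoc : ∀ M N P → (M · N) · P ≡ M · (N · P)
·-assoc (matrix a b c d) (matrix e f g h) (matrix i j k l) = matrix-≡
  (assoc a b e f g h i k) (assoc a b e f g h j l) (assoc c d e f g h i k) (assoc c d e f g h j l)
  where
  assoc : ∀ r s e f g h p q →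
    (r * e + s * g) * p + (r * f + s * h) * q ≡ r * (e * p + f * q) + s * (g * p + h * q)
  assoc = solve-∀

cohnWord-++ : ∀ x y → cohnWord (x ++ y) ≡ cohnWord x · cohnWord y
cohnWord-++ []      y = matrix-≡ (unit _) (unit _) (sym (+-identityʳ _)) (sym (+-identityʳ _))
  where
  unit : ∀ n → n ≡ 1 * n + 0
  unit = solve-∀
cohnWord-++ (ℓ ∷ x) y rewrite cohnWord-++ x y = sym (·-assoc (cohn ℓ) (cohnWord x) (cohnWord y))

Unimodular : Matrix → Set
Unimodular M = m₁₁ M * m₂₂ M ≡ 1 + m₁₂ M * m₂₁ M


letter-unimodular : ∀ ℓ M → Unimodular M → Unimodular (cohn ℓ · M)
letter-unimodular u (matrix a b c d) eq =
  trans (lhs a b c d) (trans (cong (_+ (2 * a * b + a * d + b * c + c * d)) eq) (rhs a b c d))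
  where
  lhs : ∀ a b c d → (2 * a + 1 * c) * (1 * b + 1 * d) ≡ a * d + (2 * a * b + a * d + b * c + c * d)
  lhs = solve-∀
  rhs : ∀ a b c d → 1 + b * c + (2 * a * b + a * d + b * c + c * d) ≡
                    1 + (2 * b + 1 * d) * (1 * a + 1 * c)
  rhs = solve-∀
letter-unimodular v (matrix a b c d) eq =
  trans (lhs a b c d) (trans (cong (_+ X) eq) (rhs a b c d))
  where
  X = 10 * a * b + 4 * a * d + 4 * b * c + 2 * c * d
  lhs : ∀ a b c d → (5 * a + 2 * c) * (2 * b + 1 * d) ≡
                    a * d + (10 * a * b + 4 * a * d + 4 * b * c + 2 * c * d)
  lhs = solve-∀
  rhs : ∀ a b c d → 1 + b * c + (10 * a * b + 4 * a * d + 4 * b * c + 2 * c * d) ≡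
                    1 + (5 * b + 2 * d) * (2 * a + 1 * c)
  rhs = solve-∀

unimodular : ∀ w → Unimodular (cohnWord w)
unimodular []      = refl
unimodular (ℓ ∷ w) = letter-unimodular ℓ (cohnWord w) (unimodular w)

trace≥2 : ∀ M → Unimodular M → 2 ≤ m₁₁ M + m₂₂ M
trace≥2 (matrix zero    b c d)       ()
trace≥2 (matrix (suc a) b c zero)    eq with () ← trans (sym eq) (*-zeroʳ a)
trace≥2 (matrix (suc a) b c (suc d)) eq = s≤s (≤-trans (s≤s z≤n) (m≤n+m (suc d) a))

-- The row (r , s) times the matrix, or its square, times the column (p , q).
once twice : Matrix → (r s p q : ℕ) → ℕ
once  (matrix a b c d) r s p q = r * (a * p + b * q) + s * (c * p + d * q)
twice (matrix a b c d) r s p q =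
  r * (a * (a * p + b * q) + b * (c * p + d * q)) + s * (c * (a * p + b * q) + d * (c * p + d * q))

cayley-hamilton : ∀ P r s p q → Unimodular P →
  twice P r s p q + (r * p + s * q) ≡ (m₁₁ P + m₂₂ P) * once P r s p q
-- Adding bc times (row times column) to both sides turns 1 + bc into ad, which leaves a polynomial
-- identity.
cayley-hamilton P@(matrix a b c d) r s p q eq = +-cancelʳ-≡ (b * c * (r * p + s * q)) _ _
  (trans (collect (twice P r s p q) (r * p + s * q) (b * c))
    (trans (cong (λ h → twice P r s p q + h * (r * p + s * q)) (sym eq)) (identity a b c d r s p q)))
  where
  collect : ∀ x y z → x + y + z * y ≡ x + (1 + z) * y
  collect = solve-∀
  identity : ∀ a b c d r s p q →
    (r * (a * (a * p + b * q) + b * (c * p + d * q)) + s * (c * (a * p + b * q) + d * (c * p + d * q)))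
      + a * d * (r * p + s * q)
    ≡ (a + d) * (r * (a * p + b * q) + s * (c * p + d * q)) + b * c * (r * p + s * q)
  identity = solve-∀

entry-ch : CayleyHamilton entry trace
entry-ch = record { ch = ch }
  where
  ch : ∀ x p y → entry (x ++ p ++ p ++ y) + entry (x ++ y) ≡ trace p * entry (x ++ p ++ y)
  ch x p y
    rewrite cohnWord-++ x (p ++ p ++ y) | cohnWord-++ x (p ++ y) | cohnWord-++ x y
          | cohnWord-++ p (p ++ y) | cohnWord-++ p y
    = cayley-hamilton (cohnWord p) (m₁₁ (cohnWord x)) (m₁₂ (cohnWord x))
        (m₁₂ (cohnWord y)) (m₂₂ (cohnWord y)) (unimodular p)

trace-ch : CayleyHamilton trace trace
trace-ch = record { ch = ch }
  where
  add : ∀ a b c a′ b′ c′ k → a + b ≡ k * c → a′ + b′ ≡ k * c′ → a + a′ + (b + b′) ≡ k * (c + c′)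
  add a b c a′ b′ c′ k e e′ = trans (regroup a a′ b b′)
    (trans (cong₂ _+_ e e′) (sym (*-distribˡ-+ k c c′)))
    where
    regroup : ∀ a a′ b b′ → a + a′ + (b + b′) ≡ a + b + (a′ + b′)
    regroup = solve-∀
  ch : ∀ x p y → trace (x ++ p ++ p ++ y) + trace (x ++ y) ≡ trace p * trace (x ++ p ++ y)
  ch x p y
    rewrite cohnWord-++ x (p ++ p ++ y) | cohnWord-++ x (p ++ y) | cohnWord-++ x y
          | cohnWord-++ p (p ++ y) | cohnWord-++ p y
    = add
        (twice (cohnWord p) (m₁₁ (cohnWord x)) (m₁₂ (cohnWord x)) (m₁₁ (cohnWord y)) (m₂₁ (cohnWord y)))
        (m₁₁ (cohnWord x) * m₁₁ (cohnWord y) + m₁₂ (cohnWord x) * m₂₁ (cohnWord y))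
        (once (cohnWord p) (m₁₁ (cohnWord x)) (m₁₂ (cohnWord x)) (m₁₁ (cohnWord y)) (m₂₁ (cohnWord y)))
        (twice (cohnWord p) (m₂₁ (cohnWord x)) (m₂₂ (cohnWord x)) (m₁₂ (cohnWord y)) (m₂₂ (cohnWord y)))
        (m₂₁ (cohnWord x) * m₁₂ (cohnWord y) + m₂₂ (cohnWord x) * m₂₂ (cohnWord y))
        (once (cohnWord p) (m₂₁ (cohnWord x)) (m₂₂ (cohnWord x)) (m₁₂ (cohnWord y)) (m₂₂ (cohnWord y)))
        (trace p)
        (cayley-hamilton (cohnWord p) (m₁₁ (cohnWord x)) (m₁₂ (cohnWord x))
          (m₁₁ (cohnWord y)) (m₂₁ (cohnWord y)) (unimodular p))
        (cayley-hamilton (cohnWord p) (m₂₁ (cohnWord x)) (m₂₂ (cohnWord x))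
          (m₁₂ (cohnWord y)) (m₂₂ (cohnWord y)) (unimodular p))

trace-cyclic : ∀ x y → trace (x ++ y) ≡ trace (y ++ x)
trace-cyclic x y rewrite cohnWord-++ x y | cohnWord-++ y x =
  lemma (m₁₁ (cohnWord x)) (m₁₂ (cohnWord x)) (m₂₁ (cohnWord x)) (m₂₂ (cohnWord x))
        (m₁₁ (cohnWord y)) (m₁₂ (cohnWord y)) (m₂₁ (cohnWord y)) (m₂₂ (cohnWord y))
  where
  lemma : ∀ a b c d e f g h → (a * e + b * g) + (c * f + d * h) ≡ (e * a + f * c) + (g * b + h * d)
  lemma = solve-∀

entry-++ : ∀ x w y → entry (x ++ w ++ y) ≡
  once (cohnWord w) (m₁₁ (cohnWord x)) (m₁₂ (cohnWord x)) (m₁₂ (cohnWord y)) (m₂₂ (cohnWord y))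
entry-++ x w y rewrite cohnWord-++ x (w ++ y) | cohnWord-++ w y = refl

entry-mono : ∀ x w w′ y → let M = cohnWord w ; M′ = cohnWord w′ in
  m₁₁ M ≤ m₁₁ M′ → m₁₂ M ≤ m₁₂ M′ → m₂₁ M ≤ m₂₁ M′ → m₂₂ M ≤ m₂₂ M′ →
  entry (x ++ w ++ y) ≤ entry (x ++ w′ ++ y)
entry-mono x w w′ y a b c d rewrite entry-++ x w y | entry-++ x w′ y = +-mono-≤
  (*-monoʳ-≤ (m₁₁ (cohnWord x)) (+-mono-≤ (*-monoˡ-≤ (m₁₂ (cohnWord y)) a) (*-monoˡ-≤ (m₂₂ (cohnWord y)) b)))
  (*-monoʳ-≤ (m₁₂ (cohnWord x)) (+-mono-≤ (*-monoˡ-≤ (m₁₂ (cohnWord y)) c) (*-monoˡ-≤ (m₂₂ (cohnWord y)) d)))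

entry-monoˡ : ∀ w w′ y → let M = cohnWord w ; M′ = cohnWord w′ in
  m₁₁ M ≤ m₁₁ M′ → m₁₂ M ≤ m₁₂ M′ → entry (w ++ y) ≤ entry (w′ ++ y)
entry-monoˡ w w′ y a b rewrite cohnWord-++ w y | cohnWord-++ w′ y =
  +-mono-≤ (*-monoˡ-≤ (m₁₂ (cohnWord y)) a) (*-monoˡ-≤ (m₂₂ (cohnWord y)) b)

entry-monoʳ : ∀ x w w′ → let M = cohnWord w ; M′ = cohnWord w′ in
  m₁₂ M ≤ m₁₂ M′ → m₂₂ M ≤ m₂₂ M′ → entry (x ++ w) ≤ entry (x ++ w′)
entry-monoʳ x w w′ b d rewrite cohnWord-++ x w | cohnWord-++ x w′ =
  +-mono-≤ (*-monoʳ-≤ (m₁₁ (cohnWord x)) b) (*-monoʳ-≤ (m₁₂ (cohnWord x)) d)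

cohn-functional : MarkovFunctional entry trace
cohn-functional = record
  { E-[]     = refl
  ; E-ch     = entry-ch
  ; t-ch     = trace-ch
  ; t-cyclic = trace-cyclic
  ; t≥2      = λ w → trace≥2 (cohnWord w) (unimodular w)
  ; t-u      = refl
  ; t-v      = refl
  ; t-uv     = refl
  -- K has rows (0 , 2) and (-2 , 0), hence entries of both signs. But vKu is entrywise nonnegative
  -- and uKv nonpositive, and at the front or the back of a word only the first row or the second
  -- column of K enters.
  ; inner-≥  = λ x y → entry-mono x (v ∷ uv (u ∷ [])) (v ∷ vu (u ∷ [])) y
                 (≤ᵇ⇒≤ _ _ _) (≤ᵇ⇒≤ _ _ _) (≤ᵇ⇒≤ _ _ _) (≤ᵇ⇒≤ _ _ _)
  ; left-≥   = λ y → entry-monoˡ (uv []) (vu []) y (≤ᵇ⇒≤ _ _ _) (≤ᵇ⇒≤ _ _ _)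
  ; right-≥  = λ x → entry-monoʳ x (uv []) (vu []) (≤ᵇ⇒≤ _ _ _) (≤ᵇ⇒≤ _ _ _)
  ; inner-≤  = λ x y → entry-mono x (u ∷ vu (v ∷ [])) (u ∷ uv (v ∷ [])) y
                 (≤ᵇ⇒≤ _ _ _) (≤ᵇ⇒≤ _ _ _) (≤ᵇ⇒≤ _ _ _) (≤ᵇ⇒≤ _ _ _)
  }

-- The walk computes minima over words of given content

mutate : ∀ a b c e → e + c ≡ 3 * a * b → + 3 ℤ.* + a ℤ.* + b ℤ.- + c ≡ + e
mutate a b c e eq = begin
  + 3 ℤ.* + a ℤ.* + b ℤ.- + c   ≡⟨ cong (λ h → h ℤ.* + b ℤ.- + c) (sym (ℤ.pos-* 3 a)) ⟩
  + (3 * a) ℤ.* + b ℤ.- + c     ≡⟨ cong (ℤ._- + c) (sym (ℤ.pos-* (3 * a) b)) ⟩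
  + (3 * a * b) ℤ.- + c         ≡⟨ cong (λ h → + h ℤ.- + c) (sym eq) ⟩
  + (e + c) ℤ.- + c             ≡⟨ ℤ.m-n≡m⊖n (e + c) c ⟩
  (e + c) ℤ.⊖ c                 ≡⟨ ℤ.⊖-≥ (m≤n+m c e) ⟩
  + (e + c ∸ c)                 ≡⟨ cong +_ (m+n∸n≡m e c) ⟩
  + e                           ∎
  where open ≡-Reasoning

-- When the trace of `p` is three times its value, Cayley-Hamilton for the powers of `p` is the
-- recurrence defining `multiple`.
multiple-power : ∀ {E t} → MarkovFunctional E t → ∀ p → t p ≡ 3 * E p →
                 ∀ n → multiple (+ E p) n ≡ + E (power p n)
multiple-power {E} {t} M p tp = go
  where
  open MarkovFunctional M
  open CayleyHamilton
  go : ∀ n → multiple (+ E p) n ≡ + E (power p n)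
  go zero          = cong +_ (sym E-[])
  go (suc zero)    = cong (λ w → + E w) (sym (++-identityʳ p))
  go (suc (suc n)) rewrite go (suc n) | go n =
    mutate (E p) (E (power p (suc n))) (E (power p n)) _
      (trans (ch E-ch [] p (power p n)) (cong (_* E (power p (suc n))) tp))

onlyU : ∀ w → #v w ≡ 0 → w ≡ power (u ∷ []) (#u w)
onlyU []      _ = refl
onlyU (u ∷ w) e = cong (u ∷_) (onlyU w e)

onlyV : ∀ w → #u w ≡ 0 → w ≡ power (v ∷ []) (#v w)
onlyV []      _ = refl
onlyV (v ∷ w) e = cong (v ∷_) (onlyV w e)

#-power-u : ∀ n → #u (power (u ∷ []) n) ≡ n × #v (power (u ∷ []) n) ≡ 0
#-power-u zero    = refl , refl
#-power-u (suc n) with #-power-u n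
... | a , b = cong suc a , b

#-power-v : ∀ n → #u (power (v ∷ []) n) ≡ 0 × #v (power (v ∷ []) n) ≡ n
#-power-v zero    = refl , refl
#-power-v (suc n) with #-power-v n
... | a , b = a , cong suc b

#-power-uv : ∀ n → #u (power (uv []) n) ≡ n × #v (power (uv []) n) ≡ n
#-power-uv zero    = refl , refl
#-power-uv (suc n) with #-power-uv n
... | a , b = cong suc a , cong suc b

#-substitute-σ : ∀ w → #u (substitute σ w) ≡ #u w + #v w × #v (substitute σ w) ≡ #v w
#-substitute-σ []      = refl , refl
#-substitute-σ (u ∷ w) with #-substitute-σ w
... | a , b = cong suc a , b
#-substitute-σ (v ∷ w) with #-substitute-σ w
... | a , b = trans (cong suc a) (sym (+-suc (#u w) (#v w))) , cong suc b

#-substitute-τ : ∀ w → #u (substitute τ w) ≡ #u w × #v (substitute τ w) ≡ #u w + #v w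
#-substitute-τ []      = refl , refl
#-substitute-τ (u ∷ w) with #-substitute-τ w
... | a , b = cong suc a , cong suc b
#-substitute-τ (v ∷ w) with #-substitute-τ w
... | a , b = a , trans (cong suc b) (sym (+-suc (#u w) (#v w)))

substitute-power-σ : ∀ n → substitute σ (power (v ∷ []) n) ≡ power (uv []) n
substitute-power-σ zero    = refl
substitute-power-σ (suc n) = cong (λ w → uv w) (substitute-power-σ n)

substitute-power-τ : ∀ n → substitute τ (power (u ∷ []) n) ≡ power (uv []) n
substitute-power-τ zero    = refl
substitute-power-τ (suc n) = cong (λ w → uv w) (substitute-power-τ n)

-- The minimising word is kept as data because it is later cut and recombined.
record IsMinimum (E : Word → ℕ) (s t : ℕ) (z : ℤ) : Set where
  field
    word    : Word
    #u-word : #u word ≡ s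
    #v-word : #v word ≡ t
    attains : z ≡ + E word
    minimal : ∀ w → #u w ≡ s → #v w ≡ t → E word ≤ E w

minimum-power : ∀ {E s t z} p n → z ≡ + E (power p n) →
  #u (power p n) ≡ s → #v (power p n) ≡ t →
  (∀ w → #u w ≡ s → #v w ≡ t → E (power p n) ≤ E w) → IsMinimum E s t z
minimum-power p n eq eu ev le = record
  { word = power p n ; #u-word = eu ; #v-word = ev ; attains = eq ; minimal = le }

-- `descend` replaces a word by the image of one with reduced content, and composing the functional
-- with that substitution mutates its triple of values at `u`, `v`, `uv` just as the walk does. The
-- induction therefore ranges over all Markov functionals.
walk-minimum : ∀ n s t {E tr} → MarkovFunctional E tr → s + t ≤ n →
  IsMinimum E s t (walk n s t (+ E (u ∷ [])) (+ E (v ∷ [])) (+ E (uv [])))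
walk-minimum n s zero {E} M _ = minimum-power (u ∷ []) s (multiple-power M _ t-u s)
  (proj₁ (#-power-u s)) (proj₂ (#-power-u s))
  (λ w eu ev → ≤-reflexive (cong E (sym (trans (onlyU w ev) (cong (power (u ∷ [])) eu)))))
  where open MarkovFunctional M
walk-minimum n zero (suc t) {E} M _ = minimum-power (v ∷ []) (suc t) (multiple-power M _ t-v (suc t))
  (proj₁ (#-power-v (suc t))) (proj₂ (#-power-v (suc t)))
  (λ w eu ev → ≤-reflexive (cong E (sym (trans (onlyV w eu) (cong (power (v ∷ [])) ev)))))
  where open MarkovFunctional M
walk-minimum (suc n) (suc s) (suc t) {E} M (s≤s le) with <-cmp (suc s) (suc t)
... | tri≈ _ refl _ = minimum-power (uv []) (suc s) (multiple-power M _ t-uv (suc s))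
  (proj₁ (#-power-uv (suc s))) (proj₂ (#-power-uv (suc s))) minimal
  where
  open MarkovFunctional M
  minimal : ∀ w → #u w ≡ suc s → #v w ≡ suc s → E (power (uv []) (suc s)) ≤ E w
  minimal w eu ev with Minimality.descend M w
  -- Equal counts leave no `u` in `w′`, so it is a power of `v` and its image is the power of `uv`.
  ... | inj₁ (w′ , E≤ , a , b) rewrite eu | ev
    | onlyV w′ (+-cancelʳ-≡ (suc s) (#u w′) 0 a) | proj₂ (#-power-v (#v w′)) | b
    | substitute-power-σ (suc s) = E≤
  ... | inj₂ (w′ , E≤ , a , b) rewrite eu | ev
    | onlyU w′ (+-cancelʳ-≡ (suc s) (#v w′) 0 a) | proj₁ (#-power-u (#u w′)) | b
    | substitute-power-τ (suc s) = E≤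
... | tri< s<t _ _ rewrite mutate (E (uv [])) (E (v ∷ [])) (E (u ∷ [])) _ (Functional.E-uvv M) = record
  { word    = substitute τ word
  ; #u-word = trans (proj₁ (#-substitute-τ word)) #u-word
  ; #v-word = trans (proj₂ (#-substitute-τ word)) (trans (cong₂ _+_ #u-word #v-word)
                (cong suc (m+[n∸m]≡n s≤t)))
  ; attains = attains
  ; minimal = below
  }
  where
  s≤t : s ≤ t
  s≤t = <⇒≤ (≤-pred s<t)
  open IsMinimum (walk-minimum n (suc s) (t ∸ s) (Functional.τ-functional M)
    (≤-trans (≤-reflexive (cong suc (m+[n∸m]≡n s≤t))) (≤-trans (m≤n+m (suc t) s) le)))
  below : ∀ w → #u w ≡ suc s → #v w ≡ suc t → E (substitute τ word) ≤ E w
  below w eu ev with Minimality.descend M w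
  -- A descent along `σ` would need at least as many letters `u` as `v`.
  ... | inj₁ (w′ , _ , a , _) rewrite eu | ev =
    ⊥-elim (<⇒≱ s<t (≤-trans (m≤n+m (suc t) (#u w′)) (≤-reflexive a)))
  ... | inj₂ (w′ , E≤ , a , b) rewrite eu | ev = ≤-trans (minimal w′ b
    (trans (sym (m+n∸n≡m (#v w′) (suc s))) (cong (_∸ suc s) a))) E≤
... | tri> _ _ t<s rewrite mutate (E (u ∷ [])) (E (uv [])) (E (v ∷ [])) _ (Functional.E-uuv M) = record
  { word    = substitute σ word
  ; #u-word = trans (proj₁ (#-substitute-σ word)) (trans (cong₂ _+_ #u-word #v-word)
                (trans (+-suc (s ∸ t) t) (cong suc (m∸n+n≡m t≤s))))
  ; #v-word = trans (proj₂ (#-substitute-σ word)) #v-word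
  ; attains = attains
  ; minimal = below
  }
  where
  t≤s : t ≤ s
  t≤s = <⇒≤ (≤-pred t<s)
  open IsMinimum (walk-minimum n (s ∸ t) (suc t) (Functional.σ-functional M)
    (≤-trans (+-monoˡ-≤ (suc t) (m∸n≤m s t)) le))
  below : ∀ w → #u w ≡ suc s → #v w ≡ suc t → E (substitute σ word) ≤ E w
  below w eu ev with Minimality.descend M w
  ... | inj₂ (w′ , _ , a , _) rewrite eu | ev =
    ⊥-elim (<⇒≱ t<s (≤-trans (m≤n+m (suc s) (#v w′)) (≤-reflexive a)))
  ... | inj₁ (w′ , E≤ , a , b) rewrite eu | ev = ≤-trans (minimal w′
    (trans (sym (m+n∸n≡m (#u w′) (suc t))) (cong (_∸ suc t) a)) b) E≤

-- Rows, lattice paths and the exchange of tails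

Row : Set
Row = ℕ × ℕ

infixl 7 _◃_
_◃_ : Row → Letter → Row
(r , s) ◃ u = 2 * r + s , r + s
(r , s) ◃ v = 5 * r + 2 * s , 2 * r + s

-- The row times the second column of the matrix of the word; the row stands for a prefix already
-- read.
value : Row → Word → ℕ
value (r , s) w = r * m₁₂ (cohnWord w) + s * m₂₂ (cohnWord w)

value-∷ : ∀ ρ ℓ w → value ρ (ℓ ∷ w) ≡ value (ρ ◃ ℓ) w
value-∷ (r , s) u w = lemma r s (m₁₂ (cohnWord w)) (m₂₂ (cohnWord w))
  where
  lemma : ∀ r s p q → r * (2 * p + 1 * q) + s * (1 * p + 1 * q) ≡ (2 * r + s) * p + (r + s) * q
  lemma = solve-∀
value-∷ (r , s) v w = lemma r s (m₁₂ (cohnWord w)) (m₂₂ (cohnWord w))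
  where
  lemma : ∀ r s p q →
    r * (5 * p + 2 * q) + s * (2 * p + 1 * q) ≡ (5 * r + 2 * s) * p + (2 * r + s) * q
  lemma = solve-∀

entry-value : ∀ w → value (1 , 0) w ≡ entry w
entry-value w = trans (+-identityʳ _) (+-identityʳ _)

infix 4 _≼_
-- Order by the ratio r / s, cross-multiplied: the determinant of the two rows is at most 0.
_≼_ : Row → Row → Set
(r , s) ≼ (r′ , s′) = r * s′ ≤ s * r′

-- Cohn matrices have determinant 1, so the determinant of the two rows does not change.
≼-◃ : ∀ ρ ρ′ ℓ → ρ ≼ ρ′ → ρ ◃ ℓ ≼ ρ′ ◃ ℓ
≼-◃ (r , s) (r′ , s′) u le = subst₂ _≤_ (lhs r s r′ s′) (rhs r s r′ s′)
  (+-monoʳ-≤ (2 * r * r′ + r * s′ + s * r′ + s * s′) le)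
  where
  lhs : ∀ r s r′ s′ → 2 * r * r′ + r * s′ + s * r′ + s * s′ + r * s′ ≡ (2 * r + s) * (r′ + s′)
  lhs = solve-∀
  rhs : ∀ r s r′ s′ → 2 * r * r′ + r * s′ + s * r′ + s * s′ + s * r′ ≡ (r + s) * (2 * r′ + s′)
  rhs = solve-∀
≼-◃ (r , s) (r′ , s′) v le = subst₂ _≤_ (lhs r s r′ s′) (rhs r s r′ s′)
  (+-monoʳ-≤ (10 * r * r′ + 4 * r * s′ + 4 * s * r′ + 2 * s * s′) le)
  where
  lhs : ∀ r s r′ s′ → 10 * r * r′ + 4 * r * s′ + 4 * s * r′ + 2 * s * s′ + r * s′
                    ≡ (5 * r + 2 * s) * (2 * r′ + s′)
  lhs = solve-∀
  rhs : ∀ r s r′ s′ → 10 * r * r′ + 4 * r * s′ + 4 * s * r′ + 2 * s * s′ + s * r′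
                    ≡ (2 * r + s) * (5 * r′ + 2 * s′)
  rhs = solve-∀

-- For nonzero rows the ratio is at most 2 after `u` and at least 2 after `v`.
◃u≼◃v : ∀ ρ ρ′ → ρ ◃ u ≼ ρ′ ◃ v
◃u≼◃v (r , s) (r′ , s′) = subst ((2 * r + s) * (2 * r′ + s′) ≤_) (lemma r s r′ s′) (m≤m+n _ _)
  where
  lemma : ∀ r s r′ s′ → (2 * r + s) * (2 * r′ + s′) + (r * r′ + 3 * s * r′ + s * s′)
                      ≡ (r + s) * (5 * r′ + 2 * s′)
  lemma = solve-∀

column : Word → Row
column w = m₁₂ (cohnWord w) , m₂₂ (cohnWord w)

-- The matrices of the letters are symmetric, so columns transform like rows and share their order.
column-∷ : ∀ ℓ w → column (ℓ ∷ w) ≡ column w ◃ ℓ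
column-∷ u w = act (m₁₂ (cohnWord w)) (m₂₂ (cohnWord w))
  where
  act : ∀ p q → (2 * p + 1 * q , 1 * p + 1 * q) ≡ (p , q) ◃ u
  act p q = cong₂ (λ p′ q′ → 2 * p + q′ , p′ + q′) (*-identityˡ p) (*-identityˡ q)
column-∷ v w = act (m₁₂ (cohnWord w)) (m₂₂ (cohnWord w))
  where
  act : ∀ p q → (5 * p + 2 * q , 2 * p + 1 * q) ≡ (p , q) ◃ v
  act p q = cong (λ q′ → 5 * p + 2 * q , 2 * p + q′) (*-identityˡ q)

rearrangement : ∀ {a b c d} → a ≤ b → c ≤ d → a * d + b * c ≤ a * c + b * d
rearrangement {a} {c = c} a≤b c≤d
  with k , refl ← m≤n⇒∃[o]m+o≡n a≤b | l , refl ← m≤n⇒∃[o]m+o≡n c≤d =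
  subst (a * (c + l) + (a + k) * c ≤_) (lemma a c k l) (m≤m+n _ (k * l))
  where
  lemma : ∀ a c k l → a * (c + l) + (a + k) * c + k * l ≡ a * c + (a + k) * (c + l)
  lemma = solve-∀

-- By Cauchy-Binet, the right side minus the left side is the determinant of the rows times that of
-- the columns, and both are at most 0.
uncross : ∀ ρ ρ′ β δ → ρ ≼ ρ′ → column β ≼ column δ →
          value ρ δ * value ρ′ β ≤ value ρ β * value ρ′ δ
uncross (r , s) (r′ , s′) β δ le le′ = subst₂ _≤_ (lhs r s r′ s′ p q p′ q′) (rhs r s r′ s′ p q p′ q′)
  (+-monoʳ-≤ (r * p * (r′ * p′) + s * q * (s′ * q′)) (rearrangement le le′))
  where
  p = proj₁ (column β)
  q = proj₂ (column β)
  p′ = proj₁ (column δ)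
  q′ = proj₂ (column δ)
  lhs : ∀ r s r′ s′ p q p′ q′ →
    r * p * (r′ * p′) + s * q * (s′ * q′) + (r * s′ * (q * p′) + s * r′ * (p * q′)) ≡
    (r * p′ + s * q′) * (r′ * p + s′ * q)
  lhs = solve-∀
  rhs : ∀ r s r′ s′ p q p′ q′ →
    r * p * (r′ * p′) + s * q * (s′ * q′) + (r * s′ * (p * q′) + s * r′ * (q * p′)) ≡
    (r * p + s * q) * (r′ * p′ + s′ * q′)
  rhs = solve-∀

-- β and δ are lattice paths, δ starting at (i , - j) relative to the start of
-- β; the rows ρ and ρ′ record what precedes them.  The paths w and w′ switch
-- from one to the other at a common point.
Crossing : (i j : ℕ) → Row → Row → Word → Word → Set
Crossing i j ρ ρ′ β δ = ∃₂ λ w w′ →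
  value ρ w * value ρ′ w′ ≤ value ρ β * value ρ′ δ ×
  #u w ≡ #u δ + i × #v w + j ≡ #v δ × #u w′ + i ≡ #u β × #v w′ ≡ #v β + j

∷-≤ˡ : ∀ ℓ ρ ρ′ w w′ β δ → value (ρ ◃ ℓ) w * value ρ′ w′ ≤ value (ρ ◃ ℓ) β * value ρ′ δ →
       value ρ (ℓ ∷ w) * value ρ′ w′ ≤ value ρ (ℓ ∷ β) * value ρ′ δ
∷-≤ˡ ℓ ρ ρ′ w w′ β δ = subst₂ _≤_ (cong (_* value ρ′ w′) (sym (value-∷ ρ ℓ w)))
                                  (cong (_* value ρ′ δ) (sym (value-∷ ρ ℓ β)))

∷-≤ʳ : ∀ ℓ ρ ρ′ w w′ β δ → value ρ w * value (ρ′ ◃ ℓ) w′ ≤ value ρ β * value (ρ′ ◃ ℓ) δ →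
       value ρ w * value ρ′ (ℓ ∷ w′) ≤ value ρ β * value ρ′ (ℓ ∷ δ)
∷-≤ʳ ℓ ρ ρ′ w w′ β δ = subst₂ _≤_ (cong (value ρ w *_) (sym (value-∷ ρ′ ℓ w′)))
                                  (cong (value ρ β *_) (sym (value-∷ ρ′ ℓ δ)))

∷-≤ : ∀ ℓ ℓ′ ρ ρ′ w w′ β δ →
      value (ρ ◃ ℓ) w * value (ρ′ ◃ ℓ′) w′ ≤ value (ρ ◃ ℓ) β * value (ρ′ ◃ ℓ′) δ →
      value ρ (ℓ ∷ w) * value ρ′ (ℓ′ ∷ w′) ≤ value ρ (ℓ ∷ β) * value ρ′ (ℓ′ ∷ δ)
∷-≤ ℓ ℓ′ ρ ρ′ w w′ β δ le =
  ∷-≤ˡ ℓ ρ ρ′ w (ℓ′ ∷ w′) β (ℓ′ ∷ δ) (∷-≤ʳ ℓ′ (ρ ◃ ℓ) ρ′ w w′ β δ le)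

-- Both starts lie on one antidiagonal, so the paths advance in step and the offset `j` changes by
-- at most 1. The end of `β` lies to the right of and below the end of `δ`, so the paths must meet
-- and then part with `β` going right and `δ` going up.
cross : ∀ j ρ ρ′ β δ → (j ≡ 0 → ρ ≼ ρ′) → #u δ + j < #u β → #v β + j < #v δ →
        Crossing j j ρ ρ′ β δ
cross j ρ ρ′ (u ∷ β) (u ∷ δ) le p q
  with cross j (ρ ◃ u) (ρ′ ◃ u) β δ (λ e → ≼-◃ ρ ρ′ u (le e)) (≤-pred p) q
... | w , w′ , ≤ , a , b , c , d =
  u ∷ w , u ∷ w′ , ∷-≤ u u ρ ρ′ w w′ β δ ≤ , cong suc a , b , cong suc c , d
cross j ρ ρ′ (v ∷ β) (v ∷ δ) le p q
  with cross j (ρ ◃ v) (ρ′ ◃ v) β δ (λ e → ≼-◃ ρ ρ′ v (le e)) p (≤-pred q)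
... | w , w′ , ≤ , a , b , c , d =
  v ∷ w , v ∷ w′ , ∷-≤ v v ρ ρ′ w w′ β δ ≤ , a , cong suc b , c , cong suc d
cross zero ρ ρ′ (u ∷ β) (v ∷ δ) le p q =
  v ∷ δ , u ∷ β ,
  uncross ρ ρ′ (u ∷ β) (v ∷ δ) (le refl)
    (subst₂ _≼_ (sym (column-∷ u β)) (sym (column-∷ v δ)) (◃u≼◃v (column β) (column δ))) ,
  sym (+-identityʳ _) , +-identityʳ _ , +-identityʳ _ , sym (+-identityʳ _)
-- Paths that meet arrive by `u` on `β` and by `v` on `δ`, which orders their rows.
cross (suc j) ρ ρ′ (u ∷ β) (v ∷ δ) le p q
  with cross j (ρ ◃ u) (ρ′ ◃ v) β δ (λ _ → ◃u≼◃v ρ ρ′)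
         (≤-pred (subst (_< suc (#u β)) (+-suc (#u δ) j) p))
         (≤-pred (subst (_< suc (#v δ)) (+-suc (#v β) j) q))
... | w , w′ , ≤ , a , b , c , d =
  u ∷ w , v ∷ w′ , ∷-≤ u v ρ ρ′ w w′ β δ ≤ ,
  trans (cong suc a) (sym (+-suc (#u δ) j)) , trans (+-suc (#v w) j) (cong suc b) ,
  trans (+-suc (#u w′) j) (cong suc c) , trans (cong suc d) (sym (+-suc (#v β) j))
-- The offset grows. At `j` = 0 the paths only touch, and the crossing lies further on.
cross j ρ ρ′ (v ∷ β) (u ∷ δ) le p q
  with cross (suc j) (ρ ◃ v) (ρ′ ◃ u) β δ (λ ())
         (subst (_< #u β) (sym (+-suc (#u δ) j)) p)
         (subst (_< #v δ) (sym (+-suc (#v β) j)) q)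
... | w , w′ , ≤ , a , b , c , d =
  v ∷ w , u ∷ w′ , ∷-≤ v u ρ ρ′ w w′ β δ ≤ ,
  trans a (+-suc (#u δ) j) , trans (sym (+-suc (#v w) j)) b ,
  trans (sym (+-suc (#u w′) j)) c , trans d (+-suc (#v β) j)

-- The path starting on the lower antidiagonal is advanced alone until both starts lie on the same
-- one. The offsets stay positive meanwhile, so the paths have not met when `cross` takes over.
align : ∀ i j ρ ρ′ β δ → #u δ + suc i < #u β → #v β + suc j < #v δ →
        Crossing (suc i) (suc j) ρ ρ′ β δ
align i j ρ ρ′ β δ p q with <-cmp i j
align i .i ρ ρ′ β δ p q | tri≈ _ refl _ = cross (suc i) ρ ρ′ β δ (λ ()) p q
align (suc i) j ρ ρ′ (u ∷ β) δ p q | tri> _ _ _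
  with align i j (ρ ◃ u) ρ′ β δ (≤-pred (subst (_< suc (#u β)) (+-suc (#u δ) (suc i)) p)) q
... | w , w′ , ≤ , a , b , c , d =
  u ∷ w , w′ , ∷-≤ˡ u ρ ρ′ w w′ β δ ≤ ,
  trans (cong suc a) (sym (+-suc (#u δ) (suc i))) , b ,
  trans (+-suc (#u w′) (suc i)) (cong suc c) , d
align (suc i) j ρ ρ′ (v ∷ β) δ p q | tri> _ _ _
  with align (suc i) (suc j) (ρ ◃ v) ρ′ β δ p (subst (_< #v δ) (sym (+-suc (#v β) (suc j))) q)
... | w , w′ , ≤ , a , b , c , d =
  v ∷ w , w′ , ∷-≤ˡ v ρ ρ′ w w′ β δ ≤ ,
  a , trans (sym (+-suc (#v w) (suc j))) b , c , trans d (+-suc (#v β) (suc j))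
align i (suc j) ρ ρ′ β (u ∷ δ) p q | tri< _ _ _
  with align (suc i) (suc j) ρ (ρ′ ◃ u) β δ (subst (_< #u β) (sym (+-suc (#u δ) (suc i))) p) q
... | w , w′ , ≤ , a , b , c , d =
  w , u ∷ w′ , ∷-≤ʳ u ρ ρ′ w w′ β δ ≤ ,
  trans a (+-suc (#u δ) (suc i)) , b , trans (sym (+-suc (#u w′) (suc i))) c , d
align i (suc j) ρ ρ′ β (v ∷ δ) p q | tri< _ _ _
  with align i j ρ (ρ′ ◃ v) β δ p (≤-pred (subst (_< suc (#v δ)) (+-suc (#v β) (suc j)) q))
... | w , w′ , ≤ , a , b , c , d =
  w , v ∷ w′ , ∷-≤ʳ v ρ ρ′ w w′ β δ ≤ ,
  a , trans (+-suc (#v w) (suc j)) (cong suc b) , c ,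
  trans (cong suc d) (sym (+-suc (#v β) (suc j)))

-- Deleting letters halves the value

Decreasing : Row → Set
Decreasing (r , s) = s ≤ r

decreasing-◃ : ∀ ρ ℓ → Decreasing (ρ ◃ ℓ)
decreasing-◃ (r , s) u = +-monoˡ-≤ s (m≤m+n r _)
decreasing-◃ (r , s) v = +-mono-≤ (*-monoˡ-≤ r (≤ᵇ⇒≤ 2 5 _)) (m≤m+n s _)

-- For `u` the new row (2r + s , r + s) dominates (2r , 2s) because s ≤ r; the row for `v` is larger
-- still.
value-double : ∀ ρ ℓ w → Decreasing ρ → 2 * value ρ w ≤ value ρ (ℓ ∷ w)
value-double (r , s) u w s≤r = subst₂ _≤_ (lhs r s p q) (sym (value-∷ (r , s) u w))
  (+-mono-≤ (*-monoˡ-≤ p (m≤m+n (2 * r) s)) (*-monoˡ-≤ q (+-monoˡ-≤ s s≤r)))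
  where
  p = proj₁ (column w)
  q = proj₂ (column w)
  lhs : ∀ r s p q → 2 * r * p + (s + s) * q ≡ 2 * (r * p + s * q)
  lhs = solve-∀
value-double (r , s) v w s≤r = subst₂ _≤_ (lhs r s p q) (sym (value-∷ (r , s) v w))
  (+-mono-≤ (*-monoˡ-≤ p (≤-trans (*-monoˡ-≤ r (≤ᵇ⇒≤ 2 5 _)) (m≤m+n (5 * r) (2 * s))))
            (*-monoˡ-≤ q (+-monoˡ-≤ s (≤-trans s≤r (m≤m+n r _)))))
  where
  p = proj₁ (column w)
  q = proj₂ (column w)
  lhs : ∀ r s p q → 2 * r * p + (s + s) * q ≡ 2 * (r * p + s * q)
  lhs = solve-∀

Deletion : Row → Word → (p q : ℕ) → Set
Deletion ρ w p q = ∃ λ w′ → #u w′ ≡ p × #v w′ ≡ q × value ρ w′ ≤ value ρ w ×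
  (p < #u w ⊎ q < #v w → 2 * value ρ w′ ≤ value ρ w)

value-∷-≤ : ∀ (f : ℕ → ℕ) ρ ℓ w w′ → f (value (ρ ◃ ℓ) w′) ≤ value (ρ ◃ ℓ) w →
            f (value ρ (ℓ ∷ w′)) ≤ value ρ (ℓ ∷ w)
value-∷-≤ f ρ ℓ w w′ =
  subst₂ (λ a b → f a ≤ b) (sym (value-∷ ρ ℓ w′)) (sym (value-∷ ρ ℓ w))

-- Surplus letters are dropped as early as possible. A single drop already gives the factor 2, so
-- after it only the weak inequality is carried along.
delete : ∀ ρ w p q → Decreasing ρ → p ≤ #u w → q ≤ #v w → Deletion ρ w p q
delete ρ []      zero zero _  _  _  = [] , refl , refl , ≤-refl , λ { (inj₁ ()) ; (inj₂ ()) }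
delete ρ (u ∷ w) p    q    ρ↓ p≤ q≤ with m≤n⇒m<n∨m≡n p≤
... | inj₁ p< with delete ρ w p q ρ↓ (≤-pred p<) q≤
...   | w′ , a , b , le , _ = w′ , a , b , ≤-trans (m≤m+n _ _) half , λ _ → half
  where
  half : 2 * value ρ w′ ≤ value ρ (u ∷ w)
  half = ≤-trans (*-monoʳ-≤ 2 le) (value-double ρ u w ρ↓)
delete ρ (u ∷ w) .(suc (#u w)) q ρ↓ p≤ q≤ | inj₂ refl
  with delete (ρ ◃ u) w (#u w) q (decreasing-◃ ρ u) ≤-refl q≤
... | w′ , a , b , le , half =
  u ∷ w′ , cong suc a , b , value-∷-≤ (λ n → n) ρ u w w′ le ,
  λ { (inj₁ lt) → ⊥-elim (<-irrefl refl lt)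
    ; (inj₂ lt) → value-∷-≤ (2 *_) ρ u w w′ (half (inj₂ lt)) }
delete ρ (v ∷ w) p    q    ρ↓ p≤ q≤ with m≤n⇒m<n∨m≡n q≤
... | inj₁ q< with delete ρ w p q ρ↓ p≤ (≤-pred q<)
...   | w′ , a , b , le , _ = w′ , a , b , ≤-trans (m≤m+n _ _) half , λ _ → half
  where
  half : 2 * value ρ w′ ≤ value ρ (v ∷ w)
  half = ≤-trans (*-monoʳ-≤ 2 le) (value-double ρ v w ρ↓)
delete ρ (v ∷ w) p .(suc (#v w)) ρ↓ p≤ q≤ | inj₂ refl
  with delete (ρ ◃ v) w p (#v w) (decreasing-◃ ρ v) p≤ ≤-refl
... | w′ , a , b , le , half =
  v ∷ w′ , a , cong suc b , value-∷-≤ (λ n → n) ρ v w w′ le ,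
  λ { (inj₁ lt) → value-∷-≤ (2 *_) ρ v w w′ (half (inj₁ lt))
    ; (inj₂ lt) → ⊥-elim (<-irrefl refl lt) }

-- Convexity at the midpoint

square-cancel-≤ : ∀ {a b} → a * a ≤ b * b → a ≤ b
square-cancel-≤ le = ≮⇒≥ λ lt → <⇒≱ (*-mono-< lt lt) le

am-gm : ∀ a b c → c * c ≤ a * b → 2 * c ≤ a + b
am-gm a b c le = square-cancel-≤ (subst (_≤ (a + b) * (a + b)) (four c)
  (≤-trans (*-monoʳ-≤ 4 le) (mean (≤-total a b))))
  where
  four : ∀ c → 4 * (c * c) ≡ 2 * c * (2 * c)
  four = solve-∀
  square : ∀ a k → 4 * (a * (a + k)) + k * k ≡ (a + (a + k)) * (a + (a + k))
  square = solve-∀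
  flip : ∀ a b → 4 * (b * a) ≡ 4 * (a * b)
  flip a b = cong (4 *_) (*-comm b a)
  ordered : ∀ a b → a ≤ b → 4 * (a * b) ≤ (a + b) * (a + b)
  ordered a b a≤b with k , refl ← m≤n⇒∃[o]m+o≡n a≤b =
    subst (4 * (a * (a + k)) ≤_) (square a k) (m≤m+n _ (k * k))
  mean : a ≤ b ⊎ b ≤ a → 4 * (a * b) ≤ (a + b) * (a + b)
  mean (inj₁ p) = ordered a b p
  mean (inj₂ p) = subst₂ _≤_ (flip a b) (cong (λ h → h * h) (+-comm b a)) (ordered b a p)

midpoint : ∀ {a b c} → 2 * b ≡ a + c → a ≤ c → ∃ λ i → a + i ≡ b × b + i ≡ c
midpoint {a} {b} {c} eq a≤c with m≤n⇒∃[o]m+o≡n a≤b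
  where
  a≤b : a ≤ b
  a≤b = *-cancelˡ-≤ 2 (≤-trans (+-monoʳ-≤ a (≤-trans (≤-reflexive (+-identityʳ a)) a≤c))
                               (≤-reflexive (sym eq)))
... | i , refl = i , refl , +-cancelˡ-≡ a _ _ (trans (lemma a i) eq)
  where
  lemma : ∀ a i → a + (a + i + i) ≡ 2 * (a + i)
  lemma = solve-∀

module Midpoint {s t s′ t′ s″ t″ z z′ z″}
  (S : 2 * s′ ≡ s + s″) (T : 2 * t′ ≡ t + t″)
  (A : IsMinimum entry s t z) (B : IsMinimum entry s′ t′ z′) (C : IsMinimum entry s″ t″ z″) where
  private
    module A = IsMinimum A
    module B = IsMinimum B
    module C = IsMinimum C

  convex-comparable : s ≤ s″ → t ≤ t″ → 2 * entry B.word ≤ entry A.word + entry C.word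
  convex-comparable s≤ t≤ with midpoint S s≤ | midpoint T t≤
  ... | i , a , b | j , c , d = cases i j a b c d
    where
    double : ∀ n → n + n ≡ 2 * n
    double = solve-∀
    strict : ∀ i j → s′ + i ≡ s″ → t′ + j ≡ t″ → s′ < s″ ⊎ t′ < t″ →
             2 * entry B.word ≤ entry A.word + entry C.word
    strict i j b d lt with delete (1 , 0) C.word s′ t′ z≤n
      (subst (s′ ≤_) (trans b (sym C.#u-word)) (m≤m+n s′ i))
      (subst (t′ ≤_) (trans d (sym C.#v-word)) (m≤m+n t′ j))
    ... | w , eu , ev , _ , half rewrite C.#u-word | C.#v-word =
      ≤-trans (*-monoʳ-≤ 2 (B.minimal w eu ev))
        (≤-trans (subst₂ (λ a b → 2 * a ≤ b) (entry-value w) (entry-value C.word) (half lt))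
                 (m≤n+m (entry C.word) (entry A.word)))
    cases : ∀ i j → s + i ≡ s′ → s′ + i ≡ s″ → t + j ≡ t′ → t′ + j ≡ t″ →
            2 * entry B.word ≤ entry A.word + entry C.word
    cases zero zero a b c d = subst (_≤ entry A.word + entry C.word) (double (entry B.word))
      (+-mono-≤ (B.minimal A.word (trans A.#u-word (trans (sym (+-identityʳ s)) a))
                                  (trans A.#v-word (trans (sym (+-identityʳ t)) c)))
                (B.minimal C.word (trans C.#u-word (trans (sym b) (+-identityʳ s′)))
                                  (trans C.#v-word (trans (sym d) (+-identityʳ t′)))))
    cases (suc i) j a b c d = strict (suc i) j b d (inj₁ (subst (s′ <_) b (m<m+n s′ z<s)))
    cases zero (suc j) a b c d = strict zero (suc j) b d (inj₂ (subst (t′ <_) d (m<m+n t′ z<s)))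

  convex-crossing : s < s″ → t″ < t → 2 * entry B.word ≤ entry A.word + entry C.word
  convex-crossing s< t> with midpoint S (<⇒≤ s<) | midpoint (trans T (+-comm t t″)) (<⇒≤ t>)
  ... | zero , a , b | _ =
    ⊥-elim (<-irrefl (trans (trans (sym (+-identityʳ s)) a) (trans (sym (+-identityʳ s′)) b)) s<)
  ... | suc i , a , b | zero , c , d =
    ⊥-elim (<-irrefl (trans (trans (sym (+-identityʳ t″)) c) (trans (sym (+-identityʳ t′)) d)) t>)
  -- With P the midpoint, the path of `C` runs from the origin to its own point and that of `A` from
  -- P - A, which is (i + 1 , - (j + 1)), to P. After the exchange both paths have content P.
  ... | suc i , a , b | suc j , c , d
    with align i j (1 , 0) (1 , 0) C.word A.word
      (subst₂ _<_ (sym (trans (cong (_+ suc i) A.#u-word) a)) (trans b (sym C.#u-word)) (m<m+n s′ z<s))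
      (subst₂ _<_ (sym (trans (cong (_+ suc j) C.#v-word) c)) (trans d (sym A.#v-word)) (m<m+n t′ z<s))
  ... | w , w′ , le , e , f , g , h
    rewrite entry-value w | entry-value w′ | entry-value C.word | entry-value A.word
          | A.#u-word | A.#v-word | C.#u-word | C.#v-word =
    subst (2 * entry B.word ≤_) (+-comm (entry C.word) (entry A.word)) (am-gm (entry C.word) (entry A.word) (entry B.word) (≤-trans (*-mono-≤
      (B.minimal w (trans e a) (+-cancelʳ-≡ (suc j) _ _ (trans f (sym d))))
      (B.minimal w′ (+-cancelʳ-≡ (suc i) _ _ (trans g (sym b))) (trans h c))) le))

convex : ∀ {s t s′ t′ s″ t″ z z′ z″} → 2 * s′ ≡ s + s″ → 2 * t′ ≡ t + t″ →
  IsMinimum entry s t z → IsMinimum entry s′ t′ z′ → IsMinimum entry s″ t″ z″ →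
  z ℤ.+ z″ ℤ.≥ + 2 ℤ.* z′
convex {s} {t} {s″ = s″} {t″} S T A B C
  rewrite IsMinimum.attains A | IsMinimum.attains B | IsMinimum.attains C
        | sym (ℤ.pos-* 2 (entry (IsMinimum.word B))) = ℤ.+≤+ cases
  where
  module M = Midpoint S T A B C
  module M′ = Midpoint (trans S (+-comm s s″)) (trans T (+-comm t t″)) C B A
  a = entry (IsMinimum.word A)
  b = entry (IsMinimum.word B)
  c = entry (IsMinimum.word C)
  swap : 2 * b ≤ c + a → 2 * b ≤ a + c
  swap = subst (2 * b ≤_) (+-comm c a)
  cases : 2 * b ≤ a + c
  cases with <-cmp s s″ | <-cmp t t″
  ... | tri< s< _ _ | tri< t< _ _ = M.convex-comparable (<⇒≤ s<) (<⇒≤ t<)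
  ... | tri< s< _ _ | tri≈ _ t≡ _ = M.convex-comparable (<⇒≤ s<) (≤-reflexive t≡)
  ... | tri< s< _ _ | tri> _ _ t> = M.convex-crossing s< t>
  ... | tri≈ _ s≡ _ | tri< t< _ _ = M.convex-comparable (≤-reflexive s≡) (<⇒≤ t<)
  ... | tri≈ _ s≡ _ | tri≈ _ t≡ _ = M.convex-comparable (≤-reflexive s≡) (≤-reflexive t≡)
  ... | tri≈ _ s≡ _ | tri> _ _ t> = swap (M′.convex-comparable (≤-reflexive (sym s≡)) (<⇒≤ t>))
  ... | tri> _ _ s> | tri< t< _ _ = swap (M′.convex-crossing s> t<)
  ... | tri> _ _ s> | tri≈ _ t≡ _ = swap (M′.convex-comparable (<⇒≤ s>) (≤-reflexive (sym t≡)))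
  ... | tri> _ _ s> | tri> _ _ t> = swap (M′.convex-comparable (<⇒≤ s>) (<⇒≤ t>))

-- The cone y ≤ x is spanned by (1 , 0) and (1 , 1), where (x , y) has the
-- coordinates x - y and y.
m-minimum : ∀ x y → y ≤ x → IsMinimum entry (x ∸ y) y (m x y)
m-minimum x       zero    _  = walk-minimum x x 0 cohn-functional (≤-reflexive (+-identityʳ x))
m-minimum (suc x) (suc y) y≤x with <-cmp (suc x) (suc y)
... | tri< x<y _ _ = ⊥-elim (<⇒≱ x<y y≤x)
... | tri≈ _ refl _ rewrite n∸n≡0 x = walk-minimum (suc x) 0 (suc x) cohn-functional ≤-refl
-- One step of the walk takes (1 , 1 , 2) to (1 , 2 , 5), the entries of `u`, `v` and `uv`.
... | tri> _ _ _ =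
  walk-minimum (x + suc y) (x ∸ y) (suc y) cohn-functional (+-monoˡ-≤ (suc y) (m∸n≤m x y))

∸-midpoint : ∀ {x y x′ y′ x″ y″} → y ≤ x → y′ ≤ x′ → y″ ≤ x″ →
  2 * x′ ≡ x + x″ → 2 * y′ ≡ y + y″ → 2 * (x′ ∸ y′) ≡ (x ∸ y) + (x″ ∸ y″)
∸-midpoint {x} {y} {x′} {y′} {x″} {y″} p p′ p″ X Y = +-cancelʳ-≡ (2 * y′) _ _ (begin
  2 * (x′ ∸ y′) + 2 * y′             ≡⟨ sym (*-distribˡ-+ 2 (x′ ∸ y′) y′) ⟩
  2 * (x′ ∸ y′ + y′)                 ≡⟨ cong (2 *_) (m∸n+n≡m p′) ⟩
  2 * x′                             ≡⟨ X ⟩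
  x + x″                             ≡⟨ sym (cong₂ _+_ (m∸n+n≡m p) (m∸n+n≡m p″)) ⟩
  (x ∸ y + y) + (x″ ∸ y″ + y″)       ≡⟨ regroup (x ∸ y) y (x″ ∸ y″) y″ ⟩
  (x ∸ y) + (x″ ∸ y″) + (y + y″)     ≡⟨ cong (λ h → (x ∸ y) + (x″ ∸ y″) + h) (sym Y) ⟩
  (x ∸ y) + (x″ ∸ y″) + 2 * y′       ∎)
  where
  open ≡-Reasoning
  regroup : ∀ a b c d → (a + b) + (c + d) ≡ a + c + (b + d)
  regroup = solve-∀

proposition1p3 : (x y x' y' x'' y'' : ℕ) → y ≤ x → y' ≤ x' → y'' ≤ x'' →
    2 * x' ≡ x + x'' → 2 * y' ≡ y + y'' →
    m x y ℤ.+ m x'' y'' ℤ.≥ + 2 ℤ.* m x' y'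
proposition1p3 x y x' y' x'' y'' p p' p'' X Y =
  convex (∸-midpoint p p' p'' X Y) Y (m-minimum x y p) (m-minimum x' y' p') (m-minimum x'' y'' p'')
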